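{- Up to isomorphism there are exactly twenty-eight graphs, with or without loops (and without multiple edges), on one, two or three vertices, namely the graphs $H_1,\ldots,H_{28}$ listed in the context. For each such $H$, each $n\ge 2$ and each $T_n\in\mathcal{T}_n$, $\hom(P_n,H)\le\hom(T_n,H)$. Moreover, for each $n\ge 2$, the trees $T_n\in\mathcal{T}_n$ minimizing $\hom(T_n,H)$ over $\mathcal{T}_n$ are as follows. (i) All trees in $\mathcal{T}_n$ are minimizers, with $\hom(T_n,H)$ equal for every $T_n\in\mathcal{T}_n$ to: $0$ for $H_1,H_3,H_9$; $1$ for $H_2,H_4,H_{10}$; $2$ for $H_5,H_6,H_{11},H_{13}$; $3$ for $H_{12},H_{14}$; $2^n$ for $H_8,H_{17}$; $2^n+1$ for $H_{18}$; $3\cdot 2^{n-1}$ for $H_{23},H_{25}$; $3^n$ for $H_{28}$. (ii) For $H_{19}$, the minimizers are precisely the trees in $\mathcal{T}_n$ that have a balanced bipartition. (iii) For $H_7,H_{15},H_{16},H_{20},H_{21},H_{22},H_{24},H_{26},H_{27}$, the path $P_n$ is the unique minimizer.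
   Context: For a graph $H$ (no multiple edges, possibly with loops) and a simple loopless graph $G$, an $H$-coloring of $G$ is a map $f:V(G)\to V(H)$ such that $f(u)\sim_H f(v)$ whenever $u\sim_G v$; $\hom(G,H)$ denotes the number of $H$-colorings of $G$. $\mathcal{T}_n$ is the set of all trees on $n$ vertices (up to isomorphism) and $P_n\in\mathcal{T}_n$ is the path on $n$ vertices. A bipartition $V(G)=X\cup Y$ of a bipartite graph is balanced if $|X|=|Y|$ when $|V(G)|$ is even and $\bigl||X|-|Y|\bigr|=1$ when $|V(G)|$ is odd. The graphs, given by edge sets, where $ij$ denotes an edge between $i$ and $j$ and $ii$ denotes a loop at $i$: On vertex set $\{1\}$: $H_1$: no edges; $H_2$: $11$. On vertex set $\{1,2\}$: $H_3$: no edges; $H_4$: $22$; $H_5$: $11,22$; $H_6$: $12$; $H_7$: $12,22$; $H_8$: $12,11,22$. On vertex set $\{1,2,3\}$: $H_9$: no edges; $H_{10}$: $22$; $H_{11}$: $11,33$; $H_{12}$: $11,22,33$; $H_{13}$: $12$; $H_{14}$: $12,33$; $H_{15}$: $12,11$; $H_{16}$: $12,11,33$; $H_{17}$: $12,11,22$; $H_{18}$: $12,11,22,33$; $H_{19}$: $12,23$; $H_{20}$: $12,23,11$; $H_{21}$: $12,23,22$; $H_{22}$: $12,23,22,33$; $H_{23}$: $12,23,11,33$; $H_{24}$: $12,23,11,22,33$; $H_{25}$: $12,23,13$; $H_{26}$: $12,23,13,11$; $H_{27}$: $12,23,13,11,22$; $H_{28}$: $12,23,13,11,22,33$. -}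

module Defs where

open import Data.Bool.Base using (Bool; false; _∧_; _∨_; T)
open import Data.Bool.ListAction using (any)
open import Data.Bool.Properties using (∧-comm; ∨-comm; T?)
open import Data.Fin.Base using (Fin; zero; suc; toℕ; fromℕ; inject₁; finToFun)
open import Data.Fin.Properties using (all?)
open import Data.Fin.Permutation using (Permutation; _⟨$⟩ʳ_)
open import Data.Fin.Subset using (Subset; _∈_; _∉_; ∣_∣; ∁)
open import Data.List.Base using (List; []; _∷_; filter; length; allFin)
open import Data.Nat.Base using (ℕ; suc; _≤_; _^_; _≡ᵇ_; ∣_-_∣)
open import Data.Nat.Divisibility using (_∣_)
open import Data.Product.Base using (∃; Σ-syntax; _×_; _,_)
open import Data.Sum.Base using (_⊎_)
open import Data.Vec.Base using (Vec; []; _∷_)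
open import Function.Definitions using (Injective)
open import Relation.Binary.Construct.Closure.ReflexiveTransitive using (Star)
open import Relation.Binary.PropositionalEquality using (_≡_; refl; trans; cong₂)
open import Relation.Nullary using (¬_; Dec)
open import Relation.Nullary.Decidable using (_→-dec_)

-- Graphs on the vertex set Fin n, without multiple edges; adj u u ≡ true means
-- that there is a loop at u.
record Graph (n : ℕ) : Set where
  field
    adj     : Fin n → Fin n → Bool
    adj-sym : ∀ u v → adj u v ≡ adj v u

  Adj : Fin n → Fin n → Set
  Adj u v = T (adj u v)

open Graph public

FiniteGraph : Set
FiniteGraph = ∃ Graph

infix 4 _≅_

_≅_ : ∀ {m n} → Graph m → Graph n → Set
_≅_ {m} {n} G H =
  Σ[ σ ∈ Permutation m n ] (∀ u v → adj G u v ≡ adj H (σ ⟨$⟩ʳ u) (σ ⟨$⟩ʳ v))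

IsColoring : ∀ {n k} → Graph n → Graph k → (Fin n → Fin k) → Set
IsColoring G H f = ∀ u v → Adj G u v → Adj H (f u) (f v)

isColoring? : ∀ {n k} (G : Graph n) (H : Graph k) (f : Fin n → Fin k) →
              Dec (IsColoring G H f)
isColoring? G H f =
  all? λ u → all? λ v → T? (adj G u v) →-dec T? (adj H (f u) (f v))

-- finToFun lists every map Fin n → Fin k exactly once (up to pointwise
-- equality) as its argument runs through Fin (k ^ n).
hom : ∀ {n k} → Graph n → Graph k → ℕ
hom {n} {k} G H =
  length (filter (λ c → isColoring? G H (finToFun {k} {n} c)) (allFin (k ^ n)))

Loopless : ∀ {n} → Graph n → Set
Loopless G = ∀ u → adj G u u ≡ false

Connected : ∀ {n} → Graph n → Set
Connected G = ∀ u v → Star (Adj G) u v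

-- The cycle c 0, c 1, …, c l, c 0 has l + 1 ≥ 3 distinct vertices.
record Cycle {n} (G : Graph n) : Set where
  field
    l         : ℕ
    2≤l       : 2 ≤ l
    c         : Fin (suc l) → Fin n
    injective : Injective _≡_ _≡_ c
    step      : ∀ (i : Fin l) → Adj G (c (inject₁ i)) (c (suc i))
    close     : Adj G (c (fromℕ l)) (c zero)

-- Used only for n ≥ 2, so the empty graph is not excluded separately.
record IsTree {n} (G : Graph n) : Set where
  field
    loopless  : Loopless G
    connected : Connected G
    acyclic   : ¬ Cycle G

path : ∀ n → Graph n
path n = record
  { adj     = λ u v → next u v ∨ next v u
  ; adj-sym = λ u v → ∨-comm (next u v) (next v u)
  }
  where
  next : Fin n → Fin n → Bool
  next u v = toℕ v ≡ᵇ suc (toℕ u)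

IsMinimizer : ∀ {n k} → Graph k → Graph n → Set
IsMinimizer {n} H t = IsTree t × (∀ (t′ : Graph n) → IsTree t′ → hom t H ≤ hom t′ H)

AllMinimize : (ℕ → ℕ) → FiniteGraph → Set
AllMinimize e (_ , H) =
  ∀ n → 2 ≤ n → (t : Graph n) → IsTree t → IsMinimizer H t × hom t H ≡ e n

PathUniqueMinimizer : FiniteGraph → Set
PathUniqueMinimizer (_ , H) =
  ∀ n → 2 ≤ n →
  IsMinimizer H (path n) × (∀ (t : Graph n) → IsMinimizer H t → t ≅ path n)

-- The classes of the bipartition are X and ∁ X.
IsBipartition : ∀ {n} → Graph n → Subset n → Set
IsBipartition G X = ∀ u v → Adj G u v → (u ∈ X × v ∉ X) ⊎ (u ∉ X × v ∈ X)

IsBalanced : ∀ {n} → Subset n → Set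
IsBalanced {n} X =
  (2 ∣ n → ∣ X ∣ ≡ ∣ ∁ X ∣) × (¬ 2 ∣ n → ∣ ∣ X ∣ - ∣ ∁ X ∣ ∣ ≡ 1)

HasBalancedBipartition : ∀ {n} → Graph n → Set
HasBalancedBipartition {n} G = Σ[ X ∈ Subset n ] (IsBipartition G X × IsBalanced X)

joins : ℕ → ℕ → ℕ × ℕ → Bool
joins a b (x , y) = ((a ≡ᵇ x) ∧ (b ≡ᵇ y)) ∨ ((a ≡ᵇ y) ∧ (b ≡ᵇ x))

joins-sym : ∀ a b e → joins a b e ≡ joins b a e
joins-sym a b (x , y) = trans
  (cong₂ _∨_ (∧-comm (a ≡ᵇ x) (b ≡ᵇ y)) (∧-comm (a ≡ᵇ y) (b ≡ᵇ x)))
  (∨-comm ((b ≡ᵇ y) ∧ (a ≡ᵇ x)) ((b ≡ᵇ x) ∧ (a ≡ᵇ y)))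

any-joins-sym : ∀ a b es → any (joins a b) es ≡ any (joins b a) es
any-joins-sym a b []       = refl
any-joins-sym a b (e ∷ es) = cong₂ _∨_ (joins-sym a b e) (any-joins-sym a b es)

-- The graph with vertices labelled 1, …, k (i : Fin k has label suc (toℕ i))
-- and the listed unordered edges, (a , a) being a loop.
fromEdges : (k : ℕ) → List (ℕ × ℕ) → FiniteGraph
fromEdges k es = k , record
  { adj     = λ u v → any (joins (suc (toℕ u)) (suc (toℕ v))) es
  ; adj-sym = λ u v → any-joins-sym (suc (toℕ u)) (suc (toℕ v)) es
  }

H₁ H₂ H₃ H₄ H₅ H₆ H₇ H₈ H₉ H₁₀ H₁₁ H₁₂ H₁₃ H₁₄
  H₁₅ H₁₆ H₁₇ H₁₈ H₁₉ H₂₀ H₂₁ H₂₂ H₂₃ H₂₄ H₂₅ H₂₆ H₂₇ H₂₈ : FiniteGraph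
H₁  = fromEdges 1 []
H₂  = fromEdges 1 ((1 , 1) ∷ [])
H₃  = fromEdges 2 []
H₄  = fromEdges 2 ((2 , 2) ∷ [])
H₅  = fromEdges 2 ((1 , 1) ∷ (2 , 2) ∷ [])
H₆  = fromEdges 2 ((1 , 2) ∷ [])
H₇  = fromEdges 2 ((1 , 2) ∷ (2 , 2) ∷ [])
H₈  = fromEdges 2 ((1 , 2) ∷ (1 , 1) ∷ (2 , 2) ∷ [])
H₉  = fromEdges 3 []
H₁₀ = fromEdges 3 ((2 , 2) ∷ [])
H₁₁ = fromEdges 3 ((1 , 1) ∷ (3 , 3) ∷ [])
H₁₂ = fromEdges 3 ((1 , 1) ∷ (2 , 2) ∷ (3 , 3) ∷ [])
H₁₃ = fromEdges 3 ((1 , 2) ∷ [])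
H₁₄ = fromEdges 3 ((1 , 2) ∷ (3 , 3) ∷ [])
H₁₅ = fromEdges 3 ((1 , 2) ∷ (1 , 1) ∷ [])
H₁₆ = fromEdges 3 ((1 , 2) ∷ (1 , 1) ∷ (3 , 3) ∷ [])
H₁₇ = fromEdges 3 ((1 , 2) ∷ (1 , 1) ∷ (2 , 2) ∷ [])
H₁₈ = fromEdges 3 ((1 , 2) ∷ (1 , 1) ∷ (2 , 2) ∷ (3 , 3) ∷ [])
H₁₉ = fromEdges 3 ((1 , 2) ∷ (2 , 3) ∷ [])
H₂₀ = fromEdges 3 ((1 , 2) ∷ (2 , 3) ∷ (1 , 1) ∷ [])
H₂₁ = fromEdges 3 ((1 , 2) ∷ (2 , 3) ∷ (2 , 2) ∷ [])
H₂₂ = fromEdges 3 ((1 , 2) ∷ (2 , 3) ∷ (2 , 2) ∷ (3 , 3) ∷ [])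
H₂₃ = fromEdges 3 ((1 , 2) ∷ (2 , 3) ∷ (1 , 1) ∷ (3 , 3) ∷ [])
H₂₄ = fromEdges 3 ((1 , 2) ∷ (2 , 3) ∷ (1 , 1) ∷ (2 , 2) ∷ (3 , 3) ∷ [])
H₂₅ = fromEdges 3 ((1 , 2) ∷ (2 , 3) ∷ (1 , 3) ∷ [])
H₂₆ = fromEdges 3 ((1 , 2) ∷ (2 , 3) ∷ (1 , 3) ∷ (1 , 1) ∷ [])
H₂₇ = fromEdges 3 ((1 , 2) ∷ (2 , 3) ∷ (1 , 3) ∷ (1 , 1) ∷ (2 , 2) ∷ [])
H₂₈ = fromEdges 3 ((1 , 2) ∷ (2 , 3) ∷ (1 , 3) ∷ (1 , 1) ∷ (2 , 2) ∷ (3 , 3) ∷ [])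

catalogue : Vec FiniteGraph 28
catalogue =
  H₁ ∷ H₂ ∷ H₃ ∷ H₄ ∷ H₅ ∷ H₆ ∷ H₇ ∷
  H₈ ∷ H₉ ∷ H₁₀ ∷ H₁₁ ∷ H₁₂ ∷ H₁₃ ∷ H₁₄ ∷
  H₁₅ ∷ H₁₆ ∷ H₁₇ ∷ H₁₈ ∷ H₁₉ ∷ H₂₀ ∷ H₂₁ ∷
  H₂₂ ∷ H₂₃ ∷ H₂₄ ∷ H₂₅ ∷ H₂₆ ∷ H₂₇ ∷ H₂₈ ∷ []

{-# OPTIONS --safe #-}

-- Root a tree and let a(c) be the number of H-colourings whose root has colour c. Grafting a
-- rooted tree with vector b at the root replaces a by a ⊙ push b, where push is multiplication by
-- the adjacency matrix A. If adjacent colours have equal degrees, then a(c) = deg(c)^(n-1), which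
-- gives (i). For (iii), the colours can be ranked so that push, like ⊙, preserves the vectors that
-- decrease along the ranking. For two such vectors a and b Chebyshev's inequality
--   2 (⟨a ⊙ Aᵐ1, b⟩ - ⟨a, Aᵐb⟩) = Σ (Aᵐ)_cd (a_c - a_d) (b_c - b_d) ≥ 0
-- says that moving a pendant path from the root to the far end of another branch does not
-- increase the number of colourings, and so all trees straighten to the path. The inequality is
-- strict at a vertex with at least two branches when the ambient vector a is strict, as it is
-- once the tree is rooted at a leaf. For (ii), a bipartition X ∪ Y gives 2^|X| + 2^|Y| colourings.

module Submission where

open import Data.Bool.Base using (Bool; true; false; T; _∧_; not; _xor_; if_then_else_)
import Data.Bool.Properties as Bool
open import Data.Bool.Properties using (T?)
open import Data.Empty using (⊥-elim)
open import Data.Fin.Base using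
  (Fin; zero; suc; toℕ; fromℕ; inject₁; inject≤; finToFun; combine; _↑ˡ_; _↑ʳ_; punchIn; punchOut)
open import Data.Fin.Patterns using (0F; 1F; 2F)
open import Data.Fin.Permutation using (Permutation; _⟨$⟩ʳ_; transpose; _∘ₚ_) renaming (id to idₚ)
open import Data.Fin.Properties using
  (_≟_; all?; any?; remQuot-combine; punchIn-punchOut; punchIn-injective; punchInᵢ≢i; injective⇒≤;
   toℕ<n; toℕ-injective; toℕ-inject≤; toℕ-inject₁; toℕ-fromℕ; inject≤-injective)
open import Data.Fin.Subset using (Subset; ∣_∣; ∁)
open import Data.Fin.Subset.Properties using (∣∁p∣≡n∸∣p∣; ∣p∣≤n)
open import Data.List.Base as List using (List; []; _∷_; filter; length)
open import Data.List.Relation.Unary.All as All using (All; []; _∷_)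
open import Data.List.Relation.Unary.Any as Any using (Any)
open import Data.Nat.Base hiding (parity)
open import Data.Nat.Divisibility using (_∣_; divides; ∣m+n∣m⇒∣n; ∣1⇒≡1)
open import Data.Nat.Properties as ℕ hiding (_≟_)
open import Data.Nat.Tactic.RingSolver using (solve-∀)
open import Data.Product.Base using (∃; ∃₂; _×_; _,_; proj₁; proj₂)
open import Data.Sum.Base as Sum using (_⊎_; inj₁; inj₂; [_,_]′)
open import Data.Sum.Properties using ([,]-cong)
open import Data.Unit.Base using (⊤; tt)
open import Data.Vec.Base using (Vec; []; _∷_; lookup; tabulate)
open import Data.Vec.Functional using (insertAt) renaming (_∷_ to infixr 5 _∷ᵛ_)
open import Data.Vec.Functional.Properties using (insertAt-lookup; insertAt-punchIn)
open import Data.Vec.Properties using ([]=⇒lookup; lookup⇒[]=; lookup-map; lookup∘tabulate)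
import Data.Vec.Relation.Unary.All as VecAll
open import Data.Vec.Relation.Unary.All.Properties using (lookup⁺)
open import Function.Base using (_∘_; id; _∋_)
open import Function.Bundles using (_⇔_; mk⇔; mk↔ₛ′; Equivalence)
open import Function.Definitions using (Injective)
open import Relation.Binary.Construct.Closure.ReflexiveTransitive using (Star; ε; _◅_; _◅◅_; gmap; reverse)
open import Relation.Binary.PropositionalEquality using
  (_≡_; _≢_; _≗_; refl; sym; trans; cong; cong₂; subst; subst₂; module ≡-Reasoning)
open import Relation.Nullary using (¬_; Dec; yes; no; does; contradiction)
open import Relation.Nullary.Decidable using
  (_×-dec_; _→-dec_; ¬?; True; toWitness; map′; from-yes; decidable-stable)
open import Relation.Unary using (Pred; Decidable)
import Algebra.Properties.Semiring.Sum +-*-semiring as ∑L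
open import Defs

-- In ⟨ a , b ⟩ the vector `a` records, for each colour of the root, in how many ways the rest of a
-- larger tree can be coloured. The induction on a branch is therefore uniform in all monotone `a`:
-- while one branch is straightened, the other branch and everything above the root belong to `a`.
-- This also shows why uniqueness needs care. For `a` = 𝟏 all differences a_c - a_d vanish and
-- Chebyshev's inequality is an equality, so nothing is gained at a branching root; at a leaf, 𝟏 is
-- replaced by `push 𝟏`, which is strict. The trees of the theorem are labelled graphs that are
-- connected and have no cycle, and `hom` filters an enumeration of all maps, whereas the induction
-- needs trees built by grafting. The bridge is the deletion of leaves: a rooted tree grows leaf by
-- leaf, together with a bijection of vertices and an identity between sums over all maps.

private variable
  k m n : ℕ


-- The library's sum unfolds to a fold, which unification cannot invert.
opaque
  ∑ : (Fin n → ℕ) → ℕ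
  ∑ = ∑L.sum

  ∑≡sum : (f : Fin n → ℕ) → ∑ f ≡ ∑L.sum f
  ∑≡sum f = refl

  ∑-cong : {f g : Fin n → ℕ} → f ≗ g → ∑ f ≡ ∑ g
  ∑-cong = ∑L.sum-cong-≗

  ∑-comm : (f : Fin m → Fin n → ℕ) → (∑ λ i → ∑ λ j → f i j) ≡ (∑ λ j → ∑ λ i → f i j)
  ∑-comm = ∑L.∑-comm

  ∑-+ : (f g : Fin n → ℕ) → (∑ λ i → f i + g i) ≡ ∑ f + ∑ g
  ∑-+ = ∑L.∑-distrib-+

  ∑-*ˡ : ∀ a (f : Fin n → ℕ) → a * ∑ f ≡ (∑ λ i → a * f i)
  ∑-*ˡ = ∑L.*-distribˡ-sum

  ∑-*ʳ : ∀ a (f : Fin n → ℕ) → ∑ f * a ≡ (∑ λ i → f i * a)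
  ∑-*ʳ = ∑L.*-distribʳ-sum

  ∑-permute : (f : Fin n → ℕ) (π : Permutation m n) → ∑ f ≡ (∑ λ i → f (π ⟨$⟩ʳ i))
  ∑-permute = ∑L.sum-permute

  ∑-one : (f : Fin 1 → ℕ) → ∑ f ≡ f zero
  ∑-one f = +-identityʳ _

  ∑-↑ : ∀ m (f : Fin (m + n) → ℕ) → ∑ f ≡ (∑ λ i → f (i ↑ˡ n)) + (∑ λ j → f (m ↑ʳ j))
  ∑-↑ zero    f = refl
  ∑-↑ (suc m) f = trans (cong (f zero +_) (∑-↑ m (f ∘ suc))) (sym (+-assoc (f zero) _ _))

  ∑-combine : ∀ m (f : Fin (m * n) → ℕ) → ∑ f ≡ (∑ λ (i : Fin m) → ∑ λ (j : Fin n) → f (combine i j))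
  ∑-combine         zero    f = refl
  ∑-combine {n = n} (suc m) f =
    trans (∑-↑ n f) (cong ((∑ λ j → f (j ↑ˡ m * n)) +_) (∑-combine m (f ∘ (n ↑ʳ_))))

-- Sums over all maps Fin n → Fin k

-- Maps that agree at every point need not be propositionally equal, so a summand is required to
-- respect pointwise equality.
Extensional : {V : Set} → ((V → Fin k) → ℕ) → Set
Extensional F = ∀ {f g} → f ≗ g → F f ≡ F g

sumMaps : ∀ n → ((Fin n → Fin k) → ℕ) → ℕ
sumMaps zero    F = F λ ()
sumMaps (suc n) F = ∑ λ c → sumMaps n λ f → F (c ∷ᵛ f)

sumMaps-cong : ∀ n {F F′ : (Fin n → Fin k) → ℕ} → F ≗ F′ → sumMaps n F ≡ sumMaps n F′
sumMaps-cong zero    F≗F′ = F≗F′ _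
sumMaps-cong (suc n) F≗F′ = ∑-cong λ c → sumMaps-cong n λ f → F≗F′ (c ∷ᵛ f)

sumMaps-*ˡ : ∀ n x (F : (Fin n → Fin k) → ℕ) → x * sumMaps n F ≡ sumMaps n λ f → x * F f
sumMaps-*ˡ zero    x F = refl
sumMaps-*ˡ (suc n) x F = trans (∑-*ˡ x _) (∑-cong λ c → sumMaps-*ˡ n x (λ f → F (c ∷ᵛ f)))

sumMaps-+ : ∀ n (F F′ : (Fin n → Fin k) → ℕ) → (sumMaps n λ f → F f + F′ f) ≡ sumMaps n F + sumMaps n F′
sumMaps-+ zero    F F′ = refl
sumMaps-+ (suc n) F F′ = trans (∑-cong λ c → sumMaps-+ n (λ f → F (c ∷ᵛ f)) (λ f → F′ (c ∷ᵛ f))) (∑-+ _ _)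

∷-cong : ∀ {A : Set} (x : A) {f g : Fin n → A} → f ≗ g → (x ∷ᵛ f) ≗ (x ∷ᵛ g)
∷-cong x f≗g zero    = refl
∷-cong x f≗g (suc i) = f≗g i

finToFun-combine : ∀ (c : Fin k) (j : Fin (k ^ n)) →
                   finToFun {k} {suc n} (combine c j) ≗ (c ∷ᵛ finToFun j)
finToFun-combine         c j zero    = cong proj₁ (remQuot-combine c j)
finToFun-combine {k} {n} c j (suc i) = cong (λ q → finToFun {k} {n} (proj₂ q) i) (remQuot-combine c j)

-- Turns the enumeration of maps by codes in `Fin (k ^ n)`, which `hom` uses, into an iterated sum
-- with one summation per vertex.
sum-finToFun : ∀ n {F : (Fin n → Fin k) → ℕ} → Extensional F →
               (∑ λ i → F (finToFun i)) ≡ sumMaps n F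
sum-finToFun         zero    ext = trans (∑-one _) (ext λ ())
sum-finToFun {k = k} (suc n) {F} ext = trans (∑-combine k _) (∑-cong λ c →
  trans (∑-cong λ j → ext (finToFun-combine c j))
        (sum-finToFun n (λ f≗g → ext (∷-cong c f≗g))))

insertAt-cong : ∀ {A : Set} {f g : Fin n → A} → f ≗ g → ∀ u x → insertAt f u x ≗ insertAt g u x
insertAt-cong             f≗g zero    x zero    = refl
insertAt-cong             f≗g zero    x (suc i) = f≗g i
insertAt-cong {n = suc n} f≗g (suc u) x zero    = f≗g zero
insertAt-cong {n = suc n} f≗g (suc u) x (suc i) = insertAt-cong (f≗g ∘ suc) u x i

-- The summation over the value at any chosen `u` can be pulled to the front: a deleted leaf may
-- carry any label.
sumMaps-insertAt : ∀ {F : (Fin (suc n) → Fin k) → ℕ} → Extensional F → ∀ u →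
                   sumMaps (suc n) F ≡ ∑ λ c → sumMaps n λ f → F (insertAt f u c)
sumMaps-insertAt {n} ext zero =
  ∑-cong λ c → sumMaps-cong n λ f → ext λ { zero → refl ; (suc i) → refl }
sumMaps-insertAt {suc n} {F = F} ext (suc u) = trans
  (∑-cong λ d → sumMaps-insertAt (λ f≗g → ext (∷-cong d f≗g)) u)
  (trans (∑-comm _)
    (∑-cong λ c → ∑-cong λ d → sumMaps-cong n λ f →
      ext λ { zero → refl ; (suc i) → refl }))

-- Indicators of decidable properties and the number of colourings

⟦_⟧ : {P : Set} → Dec P → ℕ
⟦ d ⟧ = if does d then 1 else 0

⟦⟧-true : {P : Set} (d : Dec P) → P → ⟦ d ⟧ ≡ 1
⟦⟧-true (yes _) p = refl
⟦⟧-true (no ¬p) p = contradiction p ¬p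

⟦⟧-false : {P : Set} (d : Dec P) → ¬ P → ⟦ d ⟧ ≡ 0
⟦⟧-false (yes p) ¬p = contradiction p ¬p
⟦⟧-false (no _)  ¬p = refl

⟦⟧-cong : {P Q : Set} (p : Dec P) (q : Dec Q) → (P → Q) → (Q → P) → ⟦ p ⟧ ≡ ⟦ q ⟧
⟦⟧-cong (yes p) q P→Q Q→P = sym (⟦⟧-true q (P→Q p))
⟦⟧-cong (no ¬p) q P→Q Q→P = sym (⟦⟧-false q (¬p ∘ Q→P))

length-filter-tabulate : ∀ {A : Set} {P : Pred A _} (P? : Decidable P) (f : Fin n → A) →
                         length (filter P? (List.tabulate f)) ≡ ∑ λ i → ⟦ P? (f i) ⟧
length-filter-tabulate P? f = trans (go f) (sym (∑≡sum _))
  where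
  go : ∀ {n} (f : Fin n → _) → length (filter P? (List.tabulate f)) ≡ ∑L.sum λ i → ⟦ P? (f i) ⟧
  go {zero}  f = refl
  go {suc n} f with P? (f zero)
  ... | yes _ = cong suc (go (f ∘ suc))
  ... | no  _ = go (f ∘ suc)

IsColoring-cong : ∀ (G : Graph n) (H : Graph k) {f g} → f ≗ g → IsColoring G H f → IsColoring G H g
IsColoring-cong G H f≗g f-col u v uv = subst₂ (Adj H) (f≗g u) (f≗g v) (f-col u v uv)

hom≡sumMaps : ∀ (G : Graph n) (H : Graph k) → hom G H ≡ sumMaps n λ f → ⟦ isColoring? G H f ⟧
hom≡sumMaps {n} G H = trans (length-filter-tabulate _ id) (sum-finToFun n λ f≗g →
  ⟦⟧-cong (isColoring? G H _) (isColoring? G H _)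
          (IsColoring-cong G H f≗g) (IsColoring-cong G H (sym ∘ f≗g)))

-- Rooted trees

-- graft t s joins the root of s to the root of t, which remains the root.
data RTree : Set where
  single : RTree
  graft  : RTree → RTree → RTree

Vertex : RTree → Set
Vertex single      = ⊤
Vertex (graft t s) = Vertex t ⊎ Vertex s

root : ∀ t → Vertex t
root single      = tt
root (graft t s) = inj₁ (root t)

edges : RTree → ℕ
edges single      = 0
edges (graft t s) = suc (edges s) + edges t

_≡ᵛ_ : ∀ {t} → Vertex t → Vertex t → Bool
_≡ᵛ_ {single}    _        _        = true
_≡ᵛ_ {graft t s} (inj₁ x) (inj₁ y) = x ≡ᵛ y
_≡ᵛ_ {graft t s} (inj₂ x) (inj₂ y) = x ≡ᵛ y
_≡ᵛ_ {graft t s} _        _        = false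

≡ᵛ-refl : ∀ {t} (x : Vertex t) → x ≡ᵛ x ≡ true
≡ᵛ-refl {single}    x        = refl
≡ᵛ-refl {graft t s} (inj₁ x) = ≡ᵛ-refl x
≡ᵛ-refl {graft t s} (inj₂ x) = ≡ᵛ-refl x

≡ᵛ⇒≡ : ∀ {t} (x y : Vertex t) → T (x ≡ᵛ y) → x ≡ y
≡ᵛ⇒≡ {single}    x        y        _ = refl
≡ᵛ⇒≡ {graft t s} (inj₁ x) (inj₁ y) p = cong inj₁ (≡ᵛ⇒≡ x y p)
≡ᵛ⇒≡ {graft t s} (inj₂ x) (inj₂ y) p = cong inj₂ (≡ᵛ⇒≡ x y p)

adjᵛ : ∀ {t} → Vertex t → Vertex t → Bool
adjᵛ {single}    _        _        = false
adjᵛ {graft t s} (inj₁ x) (inj₁ y) = adjᵛ x y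
adjᵛ {graft t s} (inj₂ x) (inj₂ y) = adjᵛ x y
adjᵛ {graft t s} (inj₁ x) (inj₂ y) = (x ≡ᵛ root t) ∧ (y ≡ᵛ root s)
adjᵛ {graft t s} (inj₂ y) (inj₁ x) = (x ≡ᵛ root t) ∧ (y ≡ᵛ root s)

adjᵛ-sym : ∀ {t} (x y : Vertex t) → adjᵛ x y ≡ adjᵛ y x
adjᵛ-sym {single}    x        y        = refl
adjᵛ-sym {graft t s} (inj₁ x) (inj₁ y) = adjᵛ-sym x y
adjᵛ-sym {graft t s} (inj₁ x) (inj₂ y) = refl
adjᵛ-sym {graft t s} (inj₂ x) (inj₁ y) = refl
adjᵛ-sym {graft t s} (inj₂ x) (inj₂ y) = adjᵛ-sym x y

adjᵛ-roots : ∀ {t s} → T (adjᵛ {graft t s} (inj₁ (root t)) (inj₂ (root s)))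
adjᵛ-roots {t} {s} rewrite ≡ᵛ-refl (root t) | ≡ᵛ-refl (root s) = tt

adjᵛ-graft⇒roots : ∀ {t s} {x : Vertex t} {y : Vertex s} →
                   T (adjᵛ {graft t s} (inj₁ x) (inj₂ y)) → x ≡ root t × y ≡ root s
adjᵛ-graft⇒roots {t} {s} {x} {y} p =
  let q , q′ = Equivalence.to Bool.T-∧ p in ≡ᵛ⇒≡ x (root t) q , ≡ᵛ⇒≡ y (root s) q′

-- Each vertex of `t` is one occurrence of `single`. Replacing it by `graft single single` hangs a
-- leaf on it, and the left `single` takes over its place.
addLeaf : ∀ t → Vertex t → RTree
addLeaf single      _        = graft single single
addLeaf (graft t s) (inj₁ x) = graft (addLeaf t x) s
addLeaf (graft t s) (inj₂ y) = graft t (addLeaf s y)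

edges-addLeaf : ∀ t x → edges (addLeaf t x) ≡ suc (edges t)
edges-addLeaf single      _        = refl
edges-addLeaf (graft t s) (inj₁ x) =
  trans (cong (suc (edges s) +_) (edges-addLeaf t x)) (+-suc (suc (edges s)) (edges t))
edges-addLeaf (graft t s) (inj₂ y) = cong (λ e → suc e + edges t) (edges-addLeaf s y)

old : ∀ {t} (v : Vertex t) → Vertex t → Vertex (addLeaf t v)
old {single}    _        _        = inj₁ tt
old {graft t s} (inj₁ v) (inj₁ x) = inj₁ (old v x)
old {graft t s} (inj₁ v) (inj₂ y) = inj₂ y
old {graft t s} (inj₂ v) (inj₁ x) = inj₁ x
old {graft t s} (inj₂ v) (inj₂ y) = inj₂ (old v y)

new : ∀ {t} (v : Vertex t) → Vertex (addLeaf t v)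
new {single}    _        = inj₂ tt
new {graft t s} (inj₁ v) = inj₁ (new v)
new {graft t s} (inj₂ v) = inj₂ (new v)

-- Together with `new` and `old` this makes `Vertex (addLeaf t v)` the disjoint union of a point and
-- `Vertex t`; `elim-unique` is the uniqueness in its universal property.
elim : ∀ {t} {A : Set} (v : Vertex t) → A → (Vertex t → A) → Vertex (addLeaf t v) → A
elim {single}    _        a f (inj₁ _) = f tt
elim {single}    _        a f (inj₂ _) = a
elim {graft t s} (inj₁ v) a f (inj₁ x) = elim v a (f ∘ inj₁) x
elim {graft t s} (inj₁ v) a f (inj₂ y) = f (inj₂ y)
elim {graft t s} (inj₂ v) a f (inj₁ x) = f (inj₁ x)
elim {graft t s} (inj₂ v) a f (inj₂ y) = elim v a (f ∘ inj₂) y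

elim-new : ∀ {t} {A : Set} (v : Vertex t) (a : A) f → elim v a f (new v) ≡ a
elim-new {single}    _        a f = refl
elim-new {graft t s} (inj₁ v) a f = elim-new v a (f ∘ inj₁)
elim-new {graft t s} (inj₂ v) a f = elim-new v a (f ∘ inj₂)

elim-old : ∀ {t} {A : Set} (v : Vertex t) (a : A) f x → elim v a f (old v x) ≡ f x
elim-old {single}    _        a f x        = refl
elim-old {graft t s} (inj₁ v) a f (inj₁ x) = elim-old v a (f ∘ inj₁) x
elim-old {graft t s} (inj₁ v) a f (inj₂ y) = refl
elim-old {graft t s} (inj₂ v) a f (inj₁ x) = refl
elim-old {graft t s} (inj₂ v) a f (inj₂ y) = elim-old v a (f ∘ inj₂) y

addLeaf-view : ∀ {t} (v : Vertex t) x → x ≡ new v ⊎ ∃ λ y → x ≡ old v y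
addLeaf-view {single}    _        (inj₁ _) = inj₂ (tt , refl)
addLeaf-view {single}    _        (inj₂ _) = inj₁ refl
addLeaf-view {graft t s} (inj₁ v) (inj₁ x) =
  Sum.map (cong inj₁) (λ { (y , refl) → inj₁ y , refl }) (addLeaf-view v x)
addLeaf-view {graft t s} (inj₁ v) (inj₂ x) = inj₂ (inj₂ x , refl)
addLeaf-view {graft t s} (inj₂ v) (inj₁ x) = inj₂ (inj₁ x , refl)
addLeaf-view {graft t s} (inj₂ v) (inj₂ x) =
  Sum.map (cong inj₂) (λ { (y , refl) → inj₂ y , refl }) (addLeaf-view v x)

elim-unique : ∀ {t} {A : Set} (v : Vertex t) {a : A} {f} (g : Vertex (addLeaf t v) → A) →
              g (new v) ≡ a → (∀ x → g (old v x) ≡ f x) → elim v a f ≗ g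
elim-unique v g g-new g-old x with addLeaf-view v x
... | inj₁ refl       = trans (elim-new v _ _) (sym g-new)
... | inj₂ (y , refl) = trans (elim-old v _ _ y) (sym (g-old y))

old-root : ∀ {t} (v : Vertex t) → old v (root t) ≡ root (addLeaf t v)
old-root {single}    _        = refl
old-root {graft t s} (inj₁ v) = cong inj₁ (old-root v)
old-root {graft t s} (inj₂ v) = refl

≡ᵛ-old : ∀ {t} (v x y : Vertex t) → (old v x ≡ᵛ old v y) ≡ (x ≡ᵛ y)
≡ᵛ-old {single}    v        x        y        = refl
≡ᵛ-old {graft t s} (inj₁ v) (inj₁ x) (inj₁ y) = ≡ᵛ-old v x y
≡ᵛ-old {graft t s} (inj₁ v) (inj₁ x) (inj₂ y) = refl
≡ᵛ-old {graft t s} (inj₁ v) (inj₂ x) (inj₁ y) = refl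
≡ᵛ-old {graft t s} (inj₁ v) (inj₂ x) (inj₂ y) = refl
≡ᵛ-old {graft t s} (inj₂ v) (inj₁ x) (inj₁ y) = refl
≡ᵛ-old {graft t s} (inj₂ v) (inj₁ x) (inj₂ y) = refl
≡ᵛ-old {graft t s} (inj₂ v) (inj₂ x) (inj₁ y) = refl
≡ᵛ-old {graft t s} (inj₂ v) (inj₂ x) (inj₂ y) = ≡ᵛ-old v x y

≡ᵛ-new : ∀ {t} (v x : Vertex t) → (new v ≡ᵛ old v x) ≡ false
≡ᵛ-new {single}    v        x        = refl
≡ᵛ-new {graft t s} (inj₁ v) (inj₁ x) = ≡ᵛ-new v x
≡ᵛ-new {graft t s} (inj₁ v) (inj₂ x) = refl
≡ᵛ-new {graft t s} (inj₂ v) (inj₁ x) = refl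
≡ᵛ-new {graft t s} (inj₂ v) (inj₂ x) = ≡ᵛ-new v x

old-≡ᵛ-root : ∀ {t} (v x : Vertex t) → (old v x ≡ᵛ root (addLeaf t v)) ≡ (x ≡ᵛ root t)
old-≡ᵛ-root {t} v x = trans (cong (old v x ≡ᵛ_) (sym (old-root v))) (≡ᵛ-old v x (root t))

new-≡ᵛ-root : ∀ {t} (v : Vertex t) → (new v ≡ᵛ root (addLeaf t v)) ≡ false
new-≡ᵛ-root {t} v = trans (cong (new v ≡ᵛ_) (sym (old-root v))) (≡ᵛ-new v (root t))

adjᵛ-old : ∀ {t} (v x y : Vertex t) → adjᵛ (old v x) (old v y) ≡ adjᵛ x y
adjᵛ-old {single}    v        x        y        = refl
adjᵛ-old {graft t s} (inj₁ v) (inj₁ x) (inj₁ y) = adjᵛ-old v x y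
adjᵛ-old {graft t s} (inj₁ v) (inj₁ x) (inj₂ y) = cong (_∧ (y ≡ᵛ root s)) (old-≡ᵛ-root v x)
adjᵛ-old {graft t s} (inj₁ v) (inj₂ x) (inj₁ y) = cong (_∧ (x ≡ᵛ root s)) (old-≡ᵛ-root v y)
adjᵛ-old {graft t s} (inj₁ v) (inj₂ x) (inj₂ y) = refl
adjᵛ-old {graft t s} (inj₂ v) (inj₁ x) (inj₁ y) = refl
adjᵛ-old {graft t s} (inj₂ v) (inj₁ x) (inj₂ y) = cong ((x ≡ᵛ root t) ∧_) (old-≡ᵛ-root v y)
adjᵛ-old {graft t s} (inj₂ v) (inj₂ x) (inj₁ y) = cong ((y ≡ᵛ root t) ∧_) (old-≡ᵛ-root v x)
adjᵛ-old {graft t s} (inj₂ v) (inj₂ x) (inj₂ y) = adjᵛ-old v x y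

adjᵛ-new-old : ∀ {t} (v x : Vertex t) → adjᵛ (new v) (old v x) ≡ (x ≡ᵛ v)
adjᵛ-new-old {single}    v        x        = refl
adjᵛ-new-old {graft t s} (inj₁ v) (inj₁ x) = adjᵛ-new-old v x
adjᵛ-new-old {graft t s} (inj₁ v) (inj₂ x) = cong (_∧ (x ≡ᵛ root s)) (new-≡ᵛ-root v)
adjᵛ-new-old {graft t s} (inj₂ v) (inj₁ x) =
  trans (cong ((x ≡ᵛ root t) ∧_) (new-≡ᵛ-root v)) (Bool.∧-zeroʳ _)
adjᵛ-new-old {graft t s} (inj₂ v) (inj₂ x) = adjᵛ-new-old v x

adjᵛ-irrefl : ∀ {t} (x : Vertex t) → adjᵛ x x ≡ false
adjᵛ-irrefl {single}    x        = refl
adjᵛ-irrefl {graft t s} (inj₁ x) = adjᵛ-irrefl x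
adjᵛ-irrefl {graft t s} (inj₂ x) = adjᵛ-irrefl x

-- Sums over the maps from the vertices of a rooted tree

sumVertexMaps : ∀ t → ((Vertex t → Fin k) → ℕ) → ℕ
sumVertexMaps single      F = ∑ λ c → F λ _ → c
sumVertexMaps (graft t s) F = sumVertexMaps t λ f → sumVertexMaps s λ g → F [ f , g ]′

sumVertexMaps-cong : ∀ t {F F′ : (Vertex t → Fin k) → ℕ} → F ≗ F′ →
                     sumVertexMaps t F ≡ sumVertexMaps t F′
sumVertexMaps-cong single      F≗F′ = ∑-cong λ c → F≗F′ _
sumVertexMaps-cong (graft t s) F≗F′ =
  sumVertexMaps-cong t λ f → sumVertexMaps-cong s λ g → F≗F′ _

*-distribˡ-sumVertexMaps : ∀ t a (F : (Vertex t → Fin k) → ℕ) →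
                           a * sumVertexMaps t F ≡ sumVertexMaps t λ f → a * F f
*-distribˡ-sumVertexMaps single      a F = ∑-*ˡ a _
*-distribˡ-sumVertexMaps (graft t s) a F =
  trans (*-distribˡ-sumVertexMaps t a _) (sumVertexMaps-cong t λ f → *-distribˡ-sumVertexMaps s a _)

∑-sumVertexMaps-comm : ∀ t {j} (F : Fin j → (Vertex t → Fin k) → ℕ) →
  (∑ λ c → sumVertexMaps t (F c)) ≡ sumVertexMaps t λ f → ∑ λ c → F c f
∑-sumVertexMaps-comm single      F = ∑-comm _
∑-sumVertexMaps-comm (graft t s) F =
  trans (∑-sumVertexMaps-comm t _) (sumVertexMaps-cong t λ f → ∑-sumVertexMaps-comm s _)

-- The counterpart of `sumMaps-insertAt` for rooted trees; the two carry the identity between the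
-- sums from one leaf to the next.
sumVertexMaps-addLeaf : ∀ t (v : Vertex t) {F : (Vertex (addLeaf t v) → Fin k) → ℕ} → Extensional F →
  sumVertexMaps (addLeaf t v) F ≡ ∑ λ c → sumVertexMaps t λ f → F (elim v c f)
sumVertexMaps-addLeaf single v ext =
  trans (∑-comm _) (∑-cong λ c → ∑-cong λ d → ext λ { (inj₁ _) → refl ; (inj₂ _) → refl })
sumVertexMaps-addLeaf (graft t s) (inj₁ v) ext = trans
  (sumVertexMaps-addLeaf t v λ f≗f′ → sumVertexMaps-cong s λ g → ext ([,]-cong f≗f′ λ _ → refl))
  (∑-cong λ c → sumVertexMaps-cong t λ f → sumVertexMaps-cong s λ g →
    ext λ { (inj₁ _) → refl ; (inj₂ _) → refl })
sumVertexMaps-addLeaf (graft t s) (inj₂ v) ext = trans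
  (sumVertexMaps-cong t λ f → sumVertexMaps-addLeaf s v λ g≗g′ → ext ([,]-cong (λ _ → refl) g≗g′))
  (trans (sym (∑-sumVertexMaps-comm t _))
    (∑-cong λ c → sumVertexMaps-cong t λ f → sumVertexMaps-cong s λ g →
      ext λ { (inj₁ _) → refl ; (inj₂ _) → refl }))

Adj-sym : ∀ (G : Graph n) {u v} → Adj G u v → Adj G v u
Adj-sym G {u} {v} = subst T (adj-sym G u v)

¬T⇒≡false : ∀ {b} → ¬ T b → b ≡ false
¬T⇒≡false {true}  ¬t = contradiction tt ¬t
¬T⇒≡false {false} _  = refl

irreflexive : ∀ {G : Graph n} → IsTree G → ∀ {u} → ¬ Adj G u u
irreflexive isTree {u} = subst T (IsTree.loopless isTree u)

-- Deleting a leaf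

delete : Graph (suc n) → Fin (suc n) → Graph n
delete G u = record
  { adj     = λ i j → adj G (punchIn u i) (punchIn u j)
  ; adj-sym = λ i j → adj-sym G (punchIn u i) (punchIn u j)
  }

-- Naming the neighbour through `punchIn u` makes it different from `u` and a vertex of `delete G u`
-- at once.
record Leaf (G : Graph (suc n)) (u : Fin (suc n)) : Set where
  field
    parent   : Fin n
    adjacent : Adj G u (punchIn u parent)
    unique   : ∀ w → Adj G u (punchIn u w) → w ≡ parent

data PunchView (u : Fin (suc n)) : Fin (suc n) → Set where
  hole  : PunchView u u
  punch : ∀ i → PunchView u (punchIn u i)

punchView : (u x : Fin (suc n)) → PunchView u x
punchView u x with u ≟ x
... | yes refl = hole
... | no  u≢x  = subst (PunchView u) (punchIn-punchOut u≢x) (punch (punchOut u≢x))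

module _ {G : Graph (suc n)} (isTree : IsTree G) {u : Fin (suc n)} (leaf : Leaf G u) where
  open IsTree isTree
  open Leaf leaf

  -- A walk enters and leaves the leaf `u` through `parent`, so a visit to `u` is replaced by a stay
  -- at `parent`. The two components of `walk` treat walks that start outside `u` and walks that
  -- start in `u`.
  delete-connected : Connected (delete G u)
  delete-connected i j = proj₁ (walk (connected _ _)) i refl
    where
    walk : ∀ {x} → Star (Adj G) x (punchIn u j) →
           (∀ i → x ≡ punchIn u i → Star (Adj (delete G u)) i j) ×
           (x ≡ u → Star (Adj (delete G u)) parent j)
    walk ε = (λ i eq → subst (λ i → Star _ i j) (punchIn-injective u j i eq) ε)
           , (λ eq → contradiction eq (punchInᵢ≢i u j))
    walk (_◅_ {j = y} e w) with punchView u y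
    ... | hole = (λ { i refl → subst (λ i → Star _ i j) (sym (unique i (Adj-sym G e))) (proj₂ (walk w) refl) })
               , (λ { refl → contradiction e (irreflexive isTree) })
    ... | punch y′ = (λ { i refl → e ◅ proj₁ (walk w) y′ refl })
                   , (λ { refl → proj₁ (walk w) parent (cong (punchIn u) (unique y′ e)) })

  delete-isTree : IsTree (delete G u)
  delete-isTree = record
    { loopless  = λ i → loopless (punchIn u i)
    ; connected = delete-connected
    ; acyclic   = λ cycle → let open Cycle cycle in acyclic record
      { l = l ; 2≤l = 2≤l ; c = punchIn u ∘ c
      ; injective = λ eq → injective (punchIn-injective u _ _ eq)
      ; step = step ; close = close }
    }

-- Extending a simple path that starts in r at its other end p zero must stop, and it stops at a leaf.
module _ {G : Graph n} (isTree : IsTree G) (r : Fin n) where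
  open IsTree isTree

  leaf-from-path : ∀ fuel {j} (p : Fin (2 + j) → Fin n) → Injective _≡_ _≡_ p →
    (∀ i → Adj G (p (inject₁ i)) (p (suc i))) → p (fromℕ (suc j)) ≡ r → fuel + (2 + j) ≡ suc n →
    ∃ λ u → u ≢ r × ∃ λ v → Adj G u v × ∀ w → Adj G u w → w ≡ v
  -- The fuel is `suc n` minus the number of vertices on the path, so once it is used up there would
  -- be more than `n` distinct vertices.
  leaf-from-path zero p inj step end eq =
    contradiction (injective⇒≤ inj) (<⇒≱ (≤-reflexive (sym eq)))
  leaf-from-path (suc fuel) {j} p inj step end eq
    with any? (λ w → T? (adj G (p zero) w) ×-dec ¬? (w ≟ p (suc zero)))
  ... | no none = p zero , (λ p0≡r → 0≢1+n (cong toℕ (inj (trans p0≡r (sym end))))) , p (suc zero) , step zero ,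
                  λ w e → decidable-stable (w ≟ _) λ w≢ → none (w , e , w≢)
  ... | yes (w , e , w≢p1) with any? (λ i → p i ≟ w)
  ...   | yes (zero , refl) = contradiction e (irreflexive isTree)
  ...   | yes (suc zero , refl) = contradiction refl w≢p1
  -- A further neighbour of `p zero` at position `i` ≥ 2 of the path closes `p zero`, ..., `p i`
  -- into a cycle.
  ...   | yes (i@(suc (suc _)) , refl) = contradiction cycle acyclic
    where
    l≤ : toℕ i ≤ suc j
    l≤ = s≤s⁻¹ (toℕ<n i)

    inject₁-inject≤ : ∀ x → inject≤ (inject₁ x) (s≤s l≤) ≡ inject₁ (inject≤ x l≤)
    inject₁-inject≤ x = toℕ-injective (begin
      toℕ (inject≤ (inject₁ x) (s≤s l≤)) ≡⟨ toℕ-inject≤ _ _ ⟩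
      toℕ (inject₁ x)                    ≡⟨ toℕ-inject₁ x ⟩
      toℕ x                              ≡⟨ toℕ-inject≤ x l≤ ⟨
      toℕ (inject≤ x l≤)                 ≡⟨ toℕ-inject₁ _ ⟨
      toℕ (inject₁ (inject≤ x l≤))       ∎)
      where open ≡-Reasoning

    cycle : Cycle G
    cycle = record
      { l = toℕ i ; 2≤l = s≤s (s≤s z≤n) ; c = λ x → p (inject≤ x (s≤s l≤))
      ; injective = λ eq → inject≤-injective _ _ _ _ (inj eq)
      ; step = λ x → subst (λ y → Adj G (p y) (p (suc (inject≤ x l≤))))
          (sym (inject₁-inject≤ x)) (step (inject≤ x l≤))
      ; close = subst (λ y → Adj G (p y) (p zero))
          (toℕ-injective (sym (trans (toℕ-inject≤ _ (s≤s l≤)) (toℕ-fromℕ (toℕ i))))) (Adj-sym G e)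
      }
  ...   | no w∉p = leaf-from-path fuel (w ∷ᵛ p) inj′ step′ end (trans (+-suc fuel (2 + j)) eq)
    where
    inj′ : Injective _≡_ _≡_ (w ∷ᵛ p)
    inj′ {zero}  {zero}  eq = refl
    inj′ {zero}  {suc y} eq = contradiction (y , sym eq) w∉p
    inj′ {suc x} {zero}  eq = contradiction (x , eq) w∉p
    inj′ {suc x} {suc y} eq = cong suc (inj eq)

    step′ : ∀ i → Adj G ((w ∷ᵛ p) (inject₁ i)) ((w ∷ᵛ p) (suc i))
    step′ zero    = Adj-sym G e
    step′ (suc i) = step i

neighbour : ∀ {G : Graph n} {u v} → u ≢ v → Star (Adj G) u v → ∃ λ w → Adj G u w
neighbour u≢u ε       = contradiction refl u≢u
neighbour _   (e ◅ _) = _ , e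

-- The search starts with the path formed by `r` and one of its neighbours. Since the leaf found
-- differs from `r`, it can be deleted while `r` stays the root.
exists-leaf : ∀ {G : Graph (2 + n)} → IsTree G → ∀ r → ∃ λ u → u ≢ r × Leaf G u
exists-leaf {n} {G} isTree r
  with w , e ← neighbour {G = G} (punchInᵢ≢i r zero ∘ sym) (IsTree.connected isTree r (punchIn r zero))
  with u , u≢r , v , uv , unique ← leaf-from-path isTree r (suc n) {0} (w ∷ᵛ r ∷ᵛ λ ())
    (λ { {zero}     {zero}     _    → refl
       ; {zero}     {suc zero} refl → contradiction e (irreflexive isTree)
       ; {suc zero} {zero}     refl → contradiction e (irreflexive isTree)
       ; {suc zero} {suc zero} _    → refl })
    (λ { zero → Adj-sym G e }) refl (+-comm (suc n) 2)
  with punchView u v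
... | hole     = contradiction uv (irreflexive isTree)
... | punch v′ = u , u≢r , record
  { parent = v′ ; adjacent = uv ; unique = λ w e → punchIn-injective u w v′ (unique _ e) }

-- Representing trees by rooted trees

-- The identity `sumMaps-to` is part of the data and is built along with the bijection, one
-- coordinate per leaf, so that no sum over maps is ever reindexed along a general bijection.
record Represents (G : Graph n) (r : Fin n) (t : RTree) : Set where
  field
    to          : Fin n → Vertex t
    from        : Vertex t → Fin n
    to-from     : ∀ x → to (from x) ≡ x
    from-to     : ∀ u → from (to u) ≡ u
    adj-to      : ∀ u v → adj G u v ≡ adjᵛ (to u) (to v)
    to-root     : to r ≡ root t
    order       : n ≡ suc (edges t)
    sumMaps-to  : ∀ {k} {F : (Vertex t → Fin k) → ℕ} → Extensional F →
                  (sumMaps n λ f → F (f ∘ from)) ≡ sumVertexMaps t F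

module _ {G : Graph (suc n)} (isTree : IsTree G) {u : Fin (suc n)} (leaf : Leaf G u) {r t}
         (rep : Represents (delete G u) r t) where
  open Leaf leaf
  open Represents rep

  private
    w : Vertex t
    w = to parent

    to′ : Fin (suc n) → Vertex (addLeaf t w)
    to′ = insertAt (old w ∘ to) u (new w)

    from′ : Vertex (addLeaf t w) → Fin (suc n)
    from′ = elim w u (punchIn u ∘ from)

    to′-u : to′ u ≡ new w
    to′-u = insertAt-lookup (old w ∘ to) u (new w)

    to′-punchIn : ∀ i → to′ (punchIn u i) ≡ old w (to i)
    to′-punchIn = insertAt-punchIn (old w ∘ to) u (new w)

    to′-from′ : ∀ x → to′ (from′ x) ≡ x
    to′-from′ x with addLeaf-view w x
    ... | inj₁ refl       = trans (cong to′ (elim-new w u _)) to′-u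
    ... | inj₂ (y , refl) = trans (cong to′ (elim-old w u _ y))
                              (trans (to′-punchIn (from y)) (cong (old w) (to-from y)))

    from′-to′ : ∀ x → from′ (to′ x) ≡ x
    from′-to′ x with punchView u x
    ... | hole    = trans (cong from′ to′-u) (elim-new w u _)
    ... | punch i = trans (cong from′ (to′-punchIn i))
                      (trans (elim-old w u _ (to i)) (cong (punchIn u) (from-to i)))

    adj-leaf : ∀ i → adj G u (punchIn u i) ≡ (to i ≡ᵛ w)
    adj-leaf i with i ≟ parent
    ... | yes refl = trans (Equivalence.to Bool.T-≡ adjacent) (sym (≡ᵛ-refl w))
    ... | no  i≢p  = trans (¬T⇒≡false (i≢p ∘ unique i)) (sym (¬T⇒≡false λ p →
      i≢p (trans (sym (from-to i)) (trans (cong from (≡ᵛ⇒≡ (to i) w p)) (from-to parent)))))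

    adj-to′ : ∀ x y → adj G x y ≡ adjᵛ (to′ x) (to′ y)
    adj-to′ x y with punchView u x | punchView u y
    ... | hole    | hole    = trans (IsTree.loopless isTree u) (sym (adjᵛ-irrefl (to′ u)))
    ... | hole    | punch j = trans (adj-leaf j)
      (sym (trans (cong₂ adjᵛ to′-u (to′-punchIn j)) (adjᵛ-new-old w (to j))))
    ... | punch i | hole    = trans (adj-sym G _ _) (trans (adj-leaf i)
      (sym (trans (cong₂ adjᵛ (to′-punchIn i) to′-u)
        (trans (adjᵛ-sym (old w (to i)) (new w)) (adjᵛ-new-old w (to i))))))
    ... | punch i | punch j = trans (adj-to i j)
      (sym (trans (cong₂ adjᵛ (to′-punchIn i) (to′-punchIn j)) (adjᵛ-old w (to i) (to j))))

    insertAt-from′ : ∀ {A : Set} (f : Fin n → A) c → elim w c (f ∘ from) ≗ insertAt f u c ∘ from′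
    insertAt-from′ f c = elim-unique w _
      (trans (cong (insertAt f u c) (elim-new w u _)) (insertAt-lookup f u c))
      (λ x → trans (cong (insertAt f u c) (elim-old w u _ x)) (insertAt-punchIn f u c (from x)))

    elim-cong : ∀ {A : Set} c {f g : Vertex t → A} → f ≗ g → elim w c f ≗ elim w c g
    elim-cong c f≗g = elim-unique w _ (elim-new w c _) λ x → trans (elim-old w c _ x) (sym (f≗g x))

    sumMaps-to′ : ∀ {k} {F : (Vertex (addLeaf t w) → Fin k) → ℕ} → Extensional F →
                  (sumMaps (suc n) λ f → F (f ∘ from′)) ≡ sumVertexMaps (addLeaf t w) F
    sumMaps-to′ {k} {F} ext = begin
      (sumMaps (suc n) λ f → F (f ∘ from′))
        ≡⟨ sumMaps-insertAt {F = λ f → F (f ∘ from′)} (λ f≗g → ext (f≗g ∘ from′)) u ⟩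
      (∑ λ c → sumMaps n λ f → F (insertAt f u c ∘ from′))
        ≡⟨ (∑-cong λ c → sumMaps-cong n λ f → ext (insertAt-from′ f c)) ⟨
      (∑ λ c → sumMaps n λ f → F (elim w c (f ∘ from)))
        ≡⟨ (∑-cong λ c → sumMaps-to (λ f≗g → ext (elim-cong c f≗g))) ⟩
      (∑ λ c → sumVertexMaps t λ f → F (elim w c f))
        ≡⟨ sumVertexMaps-addLeaf t w ext ⟨
      sumVertexMaps (addLeaf t w) F ∎
      where open ≡-Reasoning

  represents-addLeaf : Represents G (punchIn u r) (addLeaf t w)
  represents-addLeaf = record
    { to         = to′
    ; from       = from′
    ; to-from    = to′-from′
    ; from-to    = from′-to′
    ; adj-to     = adj-to′
    ; to-root    = trans (to′-punchIn r) (trans (cong (old w) to-root) (old-root w))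
    ; order      = cong suc (trans order (sym (edges-addLeaf t w)))
    ; sumMaps-to = sumMaps-to′
    }

-- Induction on the number of vertices: a leaf other than `r` is deleted and then hung back on the
-- image of its parent. The root is arbitrary because (iii) roots the tree at a leaf.
represent : ∀ {n} {G : Graph (suc n)} → IsTree G → ∀ r → ∃ λ t → Represents G r t
represent {zero} {G} isTree zero = single , record
  { to         = λ _ → tt
  ; from       = λ _ → zero
  ; to-from    = λ _ → refl
  ; from-to    = λ { zero → refl }
  ; adj-to     = λ { zero zero → IsTree.loopless isTree zero }
  ; to-root    = refl
  ; order      = refl
  ; sumMaps-to = λ ext → refl
  }
represent {suc n} {G} isTree r with exists-leaf isTree r
... | u , u≢r , leaf with punchView u r
...   | hole    = contradiction refl u≢r
...   | punch s = let t , rep = represent (delete-isTree isTree leaf) s in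
                  _ , represents-addLeaf isTree leaf rep

-- The path as a rooted tree

pathTree : ℕ → RTree
pathTree zero    = single
pathTree (suc m) = graft single (pathTree m)

edges-pathTree : ∀ m → edges (pathTree m) ≡ m
edges-pathTree zero    = refl
edges-pathTree (suc m) = cong suc (trans (+-identityʳ _) (edges-pathTree m))

-- Built directly, because `represent` presupposes a tree, and that the path is loopless and
-- connected is itself read off from this representation.
path-represented : ∀ m → Represents (path (suc m)) zero (pathTree m)
path-represented zero = record
  { to         = λ _ → tt
  ; from       = λ _ → zero
  ; to-from    = λ _ → refl
  ; from-to    = λ { zero → refl }
  ; adj-to     = λ { zero zero → refl }
  ; to-root    = refl
  ; order      = refl
  ; sumMaps-to = λ ext → refl
  }
path-represented (suc m) = record
  { to         = to′
  ; from       = from′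
  ; to-from    = λ { (inj₁ _) → refl ; (inj₂ x) → cong inj₂ (to-from x) }
  ; from-to    = λ { zero → refl ; (suc i) → cong suc (from-to i) }
  ; adj-to     = adj-to′
  ; to-root    = refl
  ; order      = cong suc (sym (edges-pathTree (suc m)))
  ; sumMaps-to = λ {k} {F} ext → ∑-cong λ c → trans
      (sumMaps-cong (suc m) λ f → ext {f = (c ∷ᵛ f) ∘ from′} {[ (λ _ → c) , f ∘ from ]′}
        λ { (inj₁ _) → refl ; (inj₂ _) → refl })
      (sumMaps-to {F = λ g → F [ (λ _ → c) , g ]′} λ f≗g → ext ([,]-cong (λ _ → refl) f≗g))
  }
  where
  open Represents (path-represented m)

  to′ : Fin (2 + m) → Vertex (pathTree (suc m))
  to′ zero    = inj₁ tt
  to′ (suc i) = inj₂ (to i)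

  from′ : Vertex (pathTree (suc m)) → Fin (2 + m)
  from′ (inj₁ _) = zero
  from′ (inj₂ x) = suc (from x)

  adj-zero : ∀ j → adj (path (2 + m)) zero (suc j) ≡ (to j ≡ᵛ root (pathTree m))
  adj-zero zero    = sym (trans (cong (_≡ᵛ root (pathTree m)) to-root) (≡ᵛ-refl (root (pathTree m))))
  adj-zero (suc j) = sym (¬T⇒≡false λ p → 0≢1+n (cong toℕ
    (trans (sym (from-to zero)) (trans (cong from (trans to-root (sym (≡ᵛ⇒≡ _ _ p)))) (from-to (suc j))))))

  adj-to′ : ∀ u v → adj (path (2 + m)) u v ≡ adjᵛ (to′ u) (to′ v)
  adj-to′ zero    zero    = refl
  adj-to′ zero    (suc j) = adj-zero j
  adj-to′ (suc i) zero    = trans (adj-sym (path (2 + m)) (suc i) zero) (adj-zero i)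
  adj-to′ (suc i) (suc j) = adj-to i j

-- Inequalities for sums, and the pairing of vectors

opaque
  unfolding ∑

  ∑-mono-≤ : {f g : Fin n → ℕ} → (∀ i → f i ≤ g i) → ∑ f ≤ ∑ g
  ∑-mono-≤ {zero}  f≤g = z≤n
  ∑-mono-≤ {suc n} f≤g = +-mono-≤ (f≤g zero) (∑-mono-≤ (f≤g ∘ suc))

  ∑-mono-< : {f g : Fin n → ℕ} → (∀ i → f i ≤ g i) → ∀ i → f i < g i → ∑ f < ∑ g
  ∑-mono-< f≤g zero    f<g = +-mono-<-≤ f<g (∑-mono-≤ (f≤g ∘ suc))
  ∑-mono-< f≤g (suc i) f<g = +-mono-≤-< (f≤g zero) (∑-mono-< (f≤g ∘ suc) i f<g)

  ≤-∑ : (f : Fin n → ℕ) → ∀ i → f i ≤ ∑ f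
  ≤-∑ f zero    = m≤m+n (f zero) _
  ≤-∑ f (suc i) = ≤-trans (≤-∑ (f ∘ suc) i) (m≤n+m _ (f zero))

∑-assoc : ∀ (a : Fin m → ℕ) (M : Fin m → Fin n → ℕ) (b : Fin n → ℕ) →
          (∑ λ i → a i * (∑ λ j → M i j * b j)) ≡ (∑ λ j → (∑ λ i → a i * M i j) * b j)
∑-assoc a M b = begin
  (∑ λ i → a i * (∑ λ j → M i j * b j)) ≡⟨ (∑-cong λ i → ∑-*ˡ (a i) _) ⟩
  (∑ λ i → ∑ λ j → a i * (M i j * b j)) ≡⟨ ∑-comm _ ⟩
  (∑ λ j → ∑ λ i → a i * (M i j * b j)) ≡⟨ (∑-cong λ j → ∑-cong λ i → *-assoc (a i) (M i j) (b j)) ⟨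
  (∑ λ j → ∑ λ i → a i * M i j * b j)   ≡⟨ (∑-cong λ j → ∑-*ʳ (b j) _) ⟨
  (∑ λ j → (∑ λ i → a i * M i j) * b j) ∎
  where open ≡-Reasoning

infix 8 ⟨_,_⟩
infixl 7 _⊙_

⟨_,_⟩ : (Fin k → ℕ) → (Fin k → ℕ) → ℕ
⟨ a , b ⟩ = ∑ λ c → a c * b c

_⊙_ : (Fin k → ℕ) → (Fin k → ℕ) → Fin k → ℕ
(a ⊙ b) c = a c * b c

𝟏 : Fin k → ℕ
𝟏 _ = 1

⟨⟩-congʳ : ∀ (a : Fin k → ℕ) {b b′} → b ≗ b′ → ⟨ a , b ⟩ ≡ ⟨ a , b′ ⟩
⟨⟩-congʳ a b≗b′ = ∑-cong λ c → cong (a c *_) (b≗b′ c)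

⟨⟩-⊙ : ∀ (a b c : Fin k → ℕ) → ⟨ a , b ⊙ c ⟩ ≡ ⟨ a ⊙ b , c ⟩
⟨⟩-⊙ a b c = ∑-cong λ i → sym (*-assoc (a i) (b i) (c i))

-- Counting colourings by the colour of the root

module _ (H : Graph k) where

  weight : Fin k → Fin k → ℕ
  weight c d = if adj H c d then 1 else 0

  push : (Fin k → ℕ) → Fin k → ℕ
  push a c = ∑ λ d → weight c d * a d

  rootCount : RTree → Fin k → ℕ
  rootCount single      = 𝟏
  rootCount (graft t s) = rootCount t ⊙ push (rootCount s)

  -- The indicator of the colourings of `t`, written as a product over the edges so that its sum
  -- factors along grafts.
  colouring : ∀ t → (Vertex t → Fin k) → ℕ
  colouring single      f = 1
  colouring (graft t s) f =
    colouring t (f ∘ inj₁) * colouring s (f ∘ inj₂) * weight (f (inj₁ (root t))) (f (inj₂ (root s)))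

  IsVertexColouring : ∀ t → (Vertex t → Fin k) → Set
  IsVertexColouring t f = ∀ x y → T (adjᵛ x y) → Adj H (f x) (f y)

  weight-true : ∀ {c d} → Adj H c d → weight c d ≡ 1
  weight-true {c} {d} cd with adj H c d
  ... | true = refl

  weight-false : ∀ {c d} → ¬ Adj H c d → weight c d ≡ 0
  weight-false {c} {d} ¬cd with adj H c d
  ... | true  = contradiction tt ¬cd
  ... | false = refl

  weight-sym : ∀ c d → weight c d ≡ weight d c
  weight-sym c d = cong (if_then 1 else 0) (adj-sym H c d)

  colouring-01 : ∀ t f → (colouring t f ≡ 1 × IsVertexColouring t f) ⊎
                         (colouring t f ≡ 0 × ¬ IsVertexColouring t f)
  colouring-01 single      f = inj₁ (refl , λ x y ())
  colouring-01 (graft t s) f with colouring-01 t (f ∘ inj₁) | colouring-01 s (f ∘ inj₂)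
  ... | inj₂ (eq , ¬p) | _              = inj₂ (cong (λ z → z * _ * _) eq , λ p → ¬p λ x y → p (inj₁ x) (inj₁ y))
  ... | inj₁ (eq , p)  | inj₂ (eq′ , ¬q) rewrite eq | eq′ = inj₂ (refl , λ p → ¬q λ x y → p (inj₂ x) (inj₂ y))
  ... | inj₁ (eq , p)  | inj₁ (eq′ , q) rewrite eq | eq′ with T? (adj H (f (inj₁ (root t))) (f (inj₂ (root s))))
  ...   | no  ¬e = inj₂ (trans (+-identityʳ _) (weight-false ¬e) , λ p → ¬e (p _ _ (adjᵛ-roots {t} {s})))
  ...   | yes e  = inj₁ (trans (+-identityʳ _) (weight-true e) , proper)
    where
    proper : IsVertexColouring (graft t s) f
    proper (inj₁ x) (inj₁ y) xy = p x y xy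
    proper (inj₂ x) (inj₂ y) xy = q x y xy
    proper (inj₁ x) (inj₂ y) xy with refl , refl ← adjᵛ-graft⇒roots {x = x} {y} xy = e
    proper (inj₂ y) (inj₁ x) xy with refl , refl ← adjᵛ-graft⇒roots {x = x} {y} xy = Adj-sym H e

  ⟦⟧≡colouring : ∀ {P : Set} (P? : Dec P) t f → (P → IsVertexColouring t f) → (IsVertexColouring t f → P) →
                 ⟦ P? ⟧ ≡ colouring t f
  ⟦⟧≡colouring P? t f to from with colouring-01 t f
  ... | inj₁ (eq , p)  = trans (⟦⟧-true P? (from p)) (sym eq)
  ... | inj₂ (eq , ¬p) = trans (⟦⟧-false P? (¬p ∘ to)) (sym eq)

  colouring-cong : ∀ t → Extensional (colouring t)
  colouring-cong single      f≗g = refl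
  colouring-cong (graft t s) f≗g = cong₂ _*_
    (cong₂ _*_ (colouring-cong t (f≗g ∘ inj₁)) (colouring-cong s (f≗g ∘ inj₂)))
    (cong₂ weight (f≗g _) (f≗g _))

  -- The weight φ on the colour of the root makes the induction close: for `s` it is the row of the
  -- adjacency matrix at the colour of the root of `t`, and the resulting factor
  -- `push (rootCount s)` is absorbed into the weight for `t`.
  sum-colouring : ∀ t φ → (sumVertexMaps t λ f → colouring t f * φ (f (root t))) ≡ ⟨ φ , rootCount t ⟩
  sum-colouring single      φ = ∑-cong λ c → *-comm 1 (φ c)
  sum-colouring (graft t s) φ = begin
    (sumVertexMaps t λ f → sumVertexMaps s λ g →
      colouring t f * colouring s g * weight (f (root t)) (g (root s)) * φ (f (root t)))
      ≡⟨ (sumVertexMaps-cong t λ f → sumVertexMaps-cong s λ g →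
           rearrange (colouring t f) (colouring s g) (weight (f (root t)) (g (root s))) (φ (f (root t)))) ⟩
    (sumVertexMaps t λ f → sumVertexMaps s λ g →
      (colouring t f * φ (f (root t))) * (colouring s g * weight (f (root t)) (g (root s))))
      ≡⟨ (sumVertexMaps-cong t λ f → *-distribˡ-sumVertexMaps s (colouring t f * φ (f (root t))) _) ⟨
    (sumVertexMaps t λ f → (colouring t f * φ (f (root t))) *
      (sumVertexMaps s λ g → colouring s g * weight (f (root t)) (g (root s))))
      ≡⟨ (sumVertexMaps-cong t λ f → cong ((colouring t f * φ (f (root t))) *_)
           (sum-colouring s (weight (f (root t))))) ⟩
    (sumVertexMaps t λ f → (colouring t f * φ (f (root t))) * push (rootCount s) (f (root t)))
      ≡⟨ (sumVertexMaps-cong t λ f → *-assoc (colouring t f) _ _) ⟩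
    (sumVertexMaps t λ f → colouring t f * (φ ⊙ push (rootCount s)) (f (root t)))
      ≡⟨ sum-colouring t (φ ⊙ push (rootCount s)) ⟩
    ⟨ φ ⊙ push (rootCount s) , rootCount t ⟩
      ≡⟨ (∑-cong λ c → swap (φ c) (push (rootCount s) c) (rootCount t c)) ⟩
    ⟨ φ , rootCount (graft t s) ⟩ ∎
    where
    open ≡-Reasoning
    rearrange : ∀ w x y z → w * x * y * z ≡ (w * z) * (x * y)
    rearrange = solve-∀
    swap : ∀ x y z → x * y * z ≡ x * (z * y)
    swap = solve-∀

  hom≡ : ∀ {G : Graph n} {r t} → Represents G r t → hom G H ≡ ⟨ 𝟏 , rootCount t ⟩
  hom≡ {n} {G} {r} {t} rep = begin
    hom G H                                            ≡⟨ hom≡sumMaps G H ⟩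
    (sumMaps n λ f → ⟦ isColoring? G H f ⟧)
      ≡⟨ (sumMaps-cong n λ f →
           ⟦⟧≡colouring (isColoring? G H f) t (f ∘ from) (col⇒ f) (col⇐ f)) ⟩
    (sumMaps n λ f → colouring t (f ∘ from))           ≡⟨ sumMaps-to (colouring-cong t) ⟩
    sumVertexMaps t (colouring t)                      ≡⟨ (sumVertexMaps-cong t λ f → *-identityʳ _) ⟨
    (sumVertexMaps t λ f → colouring t f * 1)          ≡⟨ sum-colouring t 𝟏 ⟩
    ⟨ 𝟏 , rootCount t ⟩                                ∎
    where
    open ≡-Reasoning
    open Represents rep
    col⇒ : ∀ f → IsColoring G H f → IsVertexColouring t (f ∘ from)
    col⇒ f p x y xy = p (from x) (from y)
      (subst T (sym (trans (adj-to _ _) (cong₂ adjᵛ (to-from x) (to-from y)))) xy)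
    col⇐ : ∀ f → IsVertexColouring t (f ∘ from) → IsColoring G H f
    col⇐ f p u v uv = subst₂ (λ u v → Adj H (f u) (f v)) (from-to u) (from-to v)
      (p (to u) (to v) (subst T (adj-to u v) uv))

  -- Graphs all of whose components are regular

  degree : Fin k → ℕ
  degree c = ∑ (weight c)

  rootCount-regular : (∀ c d → Adj H c d → degree c ≡ degree d) → ∀ t c → rootCount t c ≡ degree c ^ edges t
  rootCount-regular reg single      c = refl
  rootCount-regular reg (graft t s) c = begin
    rootCount t c * (∑ λ d → weight c d * rootCount s d)
      ≡⟨ cong₂ _*_ (rootCount-regular reg t c) (∑-cong λ d → cong (weight c d *_) (rootCount-regular reg s d)) ⟩
    degree c ^ edges t * (∑ λ d → weight c d * degree d ^ edges s)
      ≡⟨ cong (degree c ^ edges t *_) (∑-cong same) ⟩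
    degree c ^ edges t * (∑ λ d → weight c d * degree c ^ edges s)
      ≡⟨ cong (degree c ^ edges t *_) (∑-*ʳ (degree c ^ edges s) (weight c)) ⟨
    degree c ^ edges t * degree c ^ suc (edges s)
      ≡⟨ *-comm (degree c ^ edges t) _ ⟩
    degree c ^ suc (edges s) * degree c ^ edges t
      ≡⟨ ^-distribˡ-+-* (degree c) (suc (edges s)) (edges t) ⟨
    degree c ^ (suc (edges s) + edges t) ∎
    where
    open ≡-Reasoning
    -- Only neighbours `d` of `c` contribute, and their degree is that of `c`.
    same : ∀ d → weight c d * degree d ^ edges s ≡ weight c d * degree c ^ edges s
    same d with T? (adj H c d)
    ... | yes cd = cong (λ x → weight c d * x ^ edges s) (sym (reg c d cd))
    ... | no ¬cd rewrite weight-false ¬cd = refl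

  -- Powers of push and walks

  push^ : ℕ → (Fin k → ℕ) → Fin k → ℕ
  push^ zero    a = a
  push^ (suc m) a = push (push^ m a)

  push-cong : ∀ {a b} → a ≗ b → push a ≗ push b
  push-cong a≗b c = ∑-cong λ d → cong (weight c d *_) (a≗b d)

  push^-+ : ∀ m n a → push^ (m + n) a ≗ push^ m (push^ n a)
  push^-+ zero    n a c = refl
  push^-+ (suc m) n a c = push-cong (push^-+ m n a) c

  push-adjoint : ∀ a b → ⟨ a , push b ⟩ ≡ ⟨ push a , b ⟩
  push-adjoint a b = trans (∑-assoc a weight b)
    (∑-cong λ c → cong (_* b c) (∑-cong λ d → trans (*-comm (a d) _) (cong (_* a d) (weight-sym d c))))

  rootCount-pathTree : ∀ m → rootCount (pathTree m) ≗ push^ m 𝟏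
  rootCount-pathTree zero    c = refl
  rootCount-pathTree (suc m) c = trans (+-identityʳ _) (push-cong (rootCount-pathTree m) c)

  hom-path : ∀ m → hom (path (suc m)) H ≡ ⟨ 𝟏 , push^ m 𝟏 ⟩
  hom-path m = trans (hom≡ (path-represented m)) (⟨⟩-congʳ 𝟏 (rootCount-pathTree m))

  -- walks m c d counts the walks of length suc m.
  walks : ℕ → Fin k → Fin k → ℕ
  walks zero    c d = weight c d
  walks (suc m) c d = ∑ λ e → weight c e * walks m e d

  walks-last : ∀ m c d → walks (suc m) c d ≡ ∑ λ e → walks m c e * weight e d
  walks-last zero    c d = refl
  walks-last (suc m) c d =
    trans (∑-cong λ e → cong (weight c e *_) (walks-last m e d)) (∑-assoc (weight c) (walks m) _)

  -- Walks are reversed: splitting off the first step from one end corresponds to splitting off the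
  -- last step from the other.
  walks-sym : ∀ m c d → walks m c d ≡ walks m d c
  walks-sym zero    c d = weight-sym c d
  walks-sym (suc m) c d = trans
    (∑-cong λ e → trans (cong₂ _*_ (weight-sym c e) (walks-sym m e d)) (*-comm _ (walks m d e)))
    (sym (walks-last m d c))

  push^-walks : ∀ m b c → push^ (suc m) b c ≡ ∑ λ d → walks m c d * b d
  push^-walks zero    b c = refl
  push^-walks (suc m) b c =
    trans (∑-cong λ e → cong (weight c e *_) (push^-walks m b e)) (∑-assoc (weight c) (walks m) b)

-- With x′ = x + p and y′ = y + q the two sides differ by p q.
rearrangement : ∀ {x x′ y y′} → x ≤ x′ → y ≤ y′ → x * y′ + x′ * y ≤ x * y + x′ * y′
rearrangement {x} {y = y} x≤x′ y≤y′
  with p , refl ← m≤n⇒∃[o]m+o≡n x≤x′ | q , refl ← m≤n⇒∃[o]m+o≡n y≤y′ =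
  ≤-trans (m≤m+n _ (p * q)) (≤-reflexive (identity x y p q))
  where
  identity : ∀ x y p q → x * (y + q) + (x + p) * y + p * q ≡ x * y + (x + p) * (y + q)
  identity = solve-∀

-- Here the difference is (p + 1)(q + 1), one more than p + q + p q.
rearrangement-< : ∀ {x x′ y y′} → x < x′ → y < y′ → x * y′ + x′ * y < x * y + x′ * y′
rearrangement-< {x} {y = y} x<x′ y<y′
  with p , refl ← m≤n⇒∃[o]m+o≡n x<x′ | q , refl ← m≤n⇒∃[o]m+o≡n y<y′ =
  ≤-trans (m≤m+n _ (p + q + p * q)) (≤-reflexive (identity x y p q))
  where
  identity : ∀ x y p q → suc (x * (suc y + q) + (suc x + p) * y) + (p + q + p * q) ≡
                         x * y + (suc x + p) * (suc y + q)
  identity = solve-∀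

-- Chebyshev's inequality along walks

SimilarAt : (a b : Fin k → ℕ) → Fin k → Fin k → Set
SimilarAt a b c d = (a c ≤ a d × b c ≤ b d) ⊎ (a d ≤ a c × b d ≤ b c)

similar-rearrangement : ∀ (a b : Fin k → ℕ) c d → SimilarAt a b c d →
                        a c * b d + a d * b c ≤ a c * b c + a d * b d
similar-rearrangement a b c d (inj₁ (a≤ , b≤)) = rearrangement a≤ b≤
similar-rearrangement a b c d (inj₂ (a≤ , b≤)) =
  subst₂ _≤_ (+-comm (a d * b c) _) (+-comm (a d * b d) _) (rearrangement a≤ b≤)

module _ (H : Graph k) (m : ℕ) (a b : Fin k → ℕ) where

  -- ⟨ a ⊙ push^ (suc m) 𝟏 , b ⟩ - ⟨ a , push^ (suc m) b ⟩ is half the sum over all c and d of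
  -- walks m c d * (a c - a d) * (b c - b d), so both sides are doubled to compare them.
  private
    ∑∑ : (Fin k → Fin k → ℕ) → ℕ
    ∑∑ g = ∑ λ c → ∑ λ d → walks H m c d * g c d

    -- The second copy has `c` and `d` exchanged, which the symmetry of `walks` permits.
    ∑∑-double : ∀ g → ∑∑ g + ∑∑ g ≡ ∑∑ λ c d → g c d + g d c
    ∑∑-double g = begin
      ∑∑ g + ∑∑ g
        ≡⟨ cong (∑∑ g +_) (trans (∑-comm _)
             (∑-cong λ d → ∑-cong λ c → cong (_* g c d) (walks-sym H m c d))) ⟩
      ∑∑ g + (∑∑ λ c d → g d c)
        ≡⟨ trans (∑-cong λ c → ∑-+ _ _) (∑-+ _ _) ⟨
      (∑ λ c → ∑ λ d → walks H m c d * g c d + walks H m c d * g d c)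
        ≡⟨ (∑-cong λ c → ∑-cong λ d → *-distribˡ-+ (walks H m c d) (g c d) (g d c)) ⟨
      (∑∑ λ c d → g c d + g d c) ∎
      where open ≡-Reasoning

    lower : ⟨ a , push^ H (suc m) b ⟩ ≡ ∑∑ λ c d → a c * b d
    lower = ∑-cong λ c → trans (cong (a c *_) (push^-walks H m b c))
      (trans (∑-*ˡ (a c) _) (∑-cong λ d → swap (a c) (walks H m c d) (b d)))
      where
      swap : ∀ x y z → x * (y * z) ≡ y * (x * z)
      swap = solve-∀

    upper : ⟨ a ⊙ push^ H (suc m) 𝟏 , b ⟩ ≡ ∑∑ λ c d → a c * b c
    upper = ∑-cong λ c → trans (cong (λ x → a c * x * b c) (push^-walks H m 𝟏 c))
      (trans (cong (_* b c) (∑-*ˡ (a c) _))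
        (trans (∑-*ʳ (b c) _) (∑-cong λ d → swap (a c) (walks H m c d) (b c))))
      where
      swap : ∀ x y z → x * (y * 1) * z ≡ y * (x * z)
      swap = solve-∀

    term-≤ : (∀ c d → SimilarAt a b c d) → ∀ c d →
             walks H m c d * (a c * b d + a d * b c) ≤ walks H m c d * (a c * b c + a d * b d)
    term-≤ sim c d = *-monoʳ-≤ (walks H m c d) (similar-rearrangement a b c d (sim c d))

    +-self-cancel-≤ : ∀ {x y} → x + x ≤ y + y → x ≤ y
    +-self-cancel-≤ x+x≤y+y = ≮⇒≥ λ y<x → <⇒≱ (+-mono-< y<x y<x) x+x≤y+y

    +-self-cancel-< : ∀ {x y} → x + x < y + y → x < y
    +-self-cancel-< x+x<y+y = ≰⇒> λ y≤x → <⇒≱ x+x<y+y (+-mono-≤ y≤x y≤x)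

  chebyshev : (∀ c d → SimilarAt a b c d) → ⟨ a , push^ H (suc m) b ⟩ ≤ ⟨ a ⊙ push^ H (suc m) 𝟏 , b ⟩
  chebyshev sim = subst₂ _≤_ (sym lower) (sym upper) (+-self-cancel-≤
    (subst₂ _≤_ (sym (∑∑-double _)) (sym (∑∑-double _)) (∑-mono-≤ λ c → ∑-mono-≤ λ d → term-≤ sim c d)))

  -- One term of the double sum becomes strict: its coefficient is positive and both of its
  -- differences are nonzero.
  chebyshev-< : (∀ c d → SimilarAt a b c d) → ∀ c d → 0 < walks H m c d → a c < a d → b c < b d →
                ⟨ a , push^ H (suc m) b ⟩ < ⟨ a ⊙ push^ H (suc m) 𝟏 , b ⟩
  chebyshev-< sim c d 0<w a< b< = subst₂ _<_ (sym lower) (sym upper) (+-self-cancel-<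
    (subst₂ _<_ (sym (∑∑-double _)) (sym (∑∑-double _))
      (∑-mono-< (λ c → ∑-mono-≤ λ d → term-≤ sim c d) c (∑-mono-< (term-≤ sim c) d
        (*-monoʳ-< (walks H m c d) {{>-nonZero 0<w}} (rearrangement-< a< b<))))))

-- Vectors that decrease along a ranking of the colours

-- A smaller rank means larger values, and equal ranks force equal values. `bottom` is the colour
-- against which strictness is measured; other colours may be ranked after it.
record Ranking (k : ℕ) : Set where
  constructor ranking
  field
    rank   : Fin k → ℕ
    bottom : Fin k

module _ (H : Graph k) (R : Ranking k) where
  open Ranking R

  -- The transposition of `i` and `j` injects the neighbours of `d` into those of `c` without
  -- raising a rank, so the sums in `push` can be compared term by term.
  Dominates : Fin k → Fin k → Fin k → Fin k → Set
  Dominates c d i j = ∀ e → Adj H d e → Adj H c (transpose i j ⟨$⟩ʳ e) × rank (transpose i j ⟨$⟩ʳ e) ≤ rank e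

  -- A neighbour of `c` that this injection misses. Its rank guarantees a value of at least that at
  -- `bottom`, hence a positive surplus.
  ExtraNeighbour : Fin k → Fin k → Fin k → Fin k → Set
  ExtraNeighbour c d i j =
    ∃ λ e → ¬ Adj H d e × Adj H c (transpose i j ⟨$⟩ʳ e) × rank (transpose i j ⟨$⟩ʳ e) ≤ rank bottom

  -- dominates makes push preserve the vectors that decrease in rank, dominates⁺ makes its values
  -- strictly smaller at bottom, and by neighbour⁺ walks of every positive length lead from bottom
  -- to a colour ranked before it. Transpositions suffice to compare the neighbourhoods in all
  -- nine graphs of (iii).
  record Admissible : Set where
    constructor admissible
    field
      dominates  : ∀ c d → rank c ≤ rank d → ∃₂ λ i j → Dominates c d i j
      dominates⁺ : ∀ c → rank c < rank bottom →
                   ∃₂ λ i j → Dominates c bottom i j × ExtraNeighbour c bottom i j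
      neighbour⁺ : ∀ c → rank c ≤ rank bottom → ∃ λ e → Adj H c e × rank e < rank bottom

  admissible? : Dec Admissible
  admissible? = map′ (λ (x , y , z) → admissible x y z) (λ (admissible x y z) → x , y , z)
    ((all? λ c → all? λ d → (rank c ≤? rank d) →-dec any? λ i → any? λ j → dom? c d i j) ×-dec
     (all? λ c → (rank c <? rank bottom) →-dec any? λ i → any? λ j → dom? c bottom i j ×-dec
       any? λ e → ¬? (T? (adj H bottom e)) ×-dec T? (adj H c (transpose i j ⟨$⟩ʳ e)) ×-dec
         rank (transpose i j ⟨$⟩ʳ e) ≤? rank bottom) ×-dec
     (all? λ c → (rank c ≤? rank bottom) →-dec any? λ e → T? (adj H c e) ×-dec rank e <? rank bottom))
    where
    dom? : ∀ c d i j → Dec (Dominates c d i j)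
    dom? c d i j = all? λ e → T? (adj H d e) →-dec
      (T? (adj H c (transpose i j ⟨$⟩ʳ e)) ×-dec rank (transpose i j ⟨$⟩ʳ e) ≤? rank e)

  Monotone : (Fin k → ℕ) → Set
  Monotone a = ∀ c d → rank c ≤ rank d → a d ≤ a c

  Strict : (Fin k → ℕ) → Set
  Strict a = Monotone a × 0 < a bottom × (∀ c → rank c < rank bottom → a bottom < a c)

  𝟏-monotone : Monotone 𝟏
  𝟏-monotone _ _ _ = ≤-refl

  ⊙-monotone : ∀ {a b} → Monotone a → Monotone b → Monotone (a ⊙ b)
  ⊙-monotone mono-a mono-b c d c≤d = *-mono-≤ (mono-a c d c≤d) (mono-b c d c≤d)

  similar : ∀ {a b} → Monotone a → Monotone b → ∀ c d → SimilarAt a b c d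
  similar mono-a mono-b c d with ≤-total (rank c) (rank d)
  ... | inj₁ c≤d = inj₂ (mono-a c d c≤d , mono-b c d c≤d)
  ... | inj₂ d≤c = inj₁ (mono-a d c d≤c , mono-b d c d≤c)

  module _ (adm : Admissible) where
    open Admissible adm

    dominated-term : ∀ {a} → Monotone a → ∀ c d i j → Dominates c d i j → ∀ e → let πe = transpose i j ⟨$⟩ʳ e in
                     weight H d e * a e ≤ weight H c πe * a πe
    dominated-term {a} mono c d i j dom e with T? (adj H d e)
    ... | no ¬de rewrite weight-false H ¬de = z≤n
    ... | yes de = let cπe , πe≤e = dom e de in
      *-mono-≤ (≤-reflexive (trans (weight-true H de) (sym (weight-true H cπe)))) (mono _ e πe≤e)

    push-monotone : ∀ {a} → Monotone a → Monotone (push H a)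
    push-monotone {a} mono c d c≤d = let i , j , dom = dominates c d c≤d in
      ≤-trans (∑-mono-≤ (dominated-term mono c d i j dom)) (≤-reflexive (sym (∑-permute _ (transpose i j))))

    -- No strictness is assumed of `a`: the surplus comes from the extra neighbour alone, whose
    -- value is at least `a bottom`.
    push-strict : ∀ {a} → Monotone a → 0 < a bottom → Strict (push H a)
    push-strict {a} mono 0<a = push-monotone mono , positive , strict
      where
      positive : 0 < push H a bottom
      positive = let e , be , e<b = neighbour⁺ bottom ≤-refl in
        <-≤-trans (<-≤-trans 0<a (mono e bottom (<⇒≤ e<b)))
          (≤-trans (≤-reflexive (sym (trans (cong (_* a e) (weight-true H be)) (+-identityʳ (a e)))))
                   (≤-∑ (λ e → weight H bottom e * a e) e))

      strict : ∀ c → rank c < rank bottom → push H a bottom < push H a c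
      strict c c<b = let i , j , dom , e , ¬be , cπe , πe≤b = dominates⁺ c c<b in
        <-≤-trans (∑-mono-< (dominated-term mono c bottom i j dom) e (begin-strict
            weight H bottom e * a e
              ≡⟨ cong (_* a e) (weight-false H ¬be) ⟩
            0                                                             <⟨ 0<a ⟩
            a bottom                                                      ≤⟨ mono _ bottom πe≤b ⟩
            a (transpose i j ⟨$⟩ʳ e)                                      ≡⟨ *-identityˡ _ ⟨
            1 * a (transpose i j ⟨$⟩ʳ e)
              ≡⟨ cong (_* a (transpose i j ⟨$⟩ʳ e)) (weight-true H cπe) ⟨
            weight H c (transpose i j ⟨$⟩ʳ e) * a (transpose i j ⟨$⟩ʳ e) ∎))
          (≤-reflexive (sym (∑-permute _ (transpose i j))))
        where open ≤-Reasoning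

    push^𝟏-strict : ∀ m → Strict (push^ H (suc m) 𝟏)
    push^𝟏-strict zero    = push-strict 𝟏-monotone (s≤s z≤n)
    push^𝟏-strict (suc m) = let mono , 0<b , _ = push^𝟏-strict m in push-strict mono 0<b

    push^𝟏-monotone : ∀ m → Monotone (push^ H m 𝟏)
    push^𝟏-monotone zero    = 𝟏-monotone
    push^𝟏-monotone (suc m) = push-monotone (push^𝟏-monotone m)

    rootCount-monotone : ∀ t → Monotone (rootCount H t)
    rootCount-monotone single      = 𝟏-monotone
    rootCount-monotone (graft t s) = ⊙-monotone (rootCount-monotone t) (push-monotone (rootCount-monotone s))

    walks-above-bottom : ∀ m c → rank c ≤ rank bottom → ∃ λ x → rank x < rank bottom × 0 < walks H m c x
    walks-above-bottom zero    c c≤b = let e , ce , e<b = neighbour⁺ c c≤b in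
      e , e<b , ≤-reflexive (sym (weight-true H ce))
    walks-above-bottom (suc m) c c≤b =
      let e , ce , e<b = neighbour⁺ c c≤b
          x , x<b , 0<w = walks-above-bottom m e (<⇒≤ e<b)
      in x , x<b , <-≤-trans 0<w (≤-trans
           (≤-reflexive (sym (trans (cong (_* walks H m e x) (weight-true H ce)) (+-identityʳ _))))
           (≤-∑ (λ e → weight H c e * walks H m e x) e))

    -- Straightening the two branches at the root of graft t s one after the other.
    graft-≤ : ∀ {a} → Monotone a → ∀ t s →
      (∀ {b} → Monotone b → ⟨ b , push^ H (edges t) 𝟏 ⟩ ≤ ⟨ b , rootCount H t ⟩) →
      (∀ {b} → Monotone b → ⟨ b , push^ H (edges s) 𝟏 ⟩ ≤ ⟨ b , rootCount H s ⟩) →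
      ⟨ a ⊙ push^ H (suc (edges s)) 𝟏 , push^ H (edges t) 𝟏 ⟩ ≤ ⟨ a , rootCount H (graft t s) ⟩
    graft-≤ {a} mono t s t≥ s≥ = begin
      ⟨ a ⊙ push H ps , pt ⟩                         ≤⟨ t≥ (⊙-monotone mono (push^𝟏-monotone (suc (edges s)))) ⟩
      ⟨ a ⊙ push H ps , rootCount H t ⟩              ≡⟨ (∑-cong λ c → swap (a c) _ _) ⟩
      ⟨ a ⊙ rootCount H t , push H ps ⟩              ≡⟨ push-adjoint H (a ⊙ rootCount H t) ps ⟩
      -- Seen from the root of `s`, the branch `t`, the connecting edge and `a` together form the
      -- monotone vector `push (a ⊙ rootCount t)`.
      ⟨ push H (a ⊙ rootCount H t) , ps ⟩            ≤⟨ s≥ (push-monotone (⊙-monotone mono (rootCount-monotone t))) ⟩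
      ⟨ push H (a ⊙ rootCount H t) , rootCount H s ⟩ ≡⟨ push-adjoint H (a ⊙ rootCount H t) (rootCount H s) ⟨
      ⟨ a ⊙ rootCount H t , push H (rootCount H s) ⟩ ≡⟨ ⟨⟩-⊙ a (rootCount H t) _ ⟨
      ⟨ a , rootCount H (graft t s) ⟩                ∎
      where
      open ≤-Reasoning
      ps = push^ H (edges s) 𝟏
      pt = push^ H (edges t) 𝟏
      swap : ∀ x y z → x * y * z ≡ x * z * y
      swap = solve-∀

    -- The path is cut into pieces with as many edges as the two branches, the connecting edge
    -- counted with `s`. Chebyshev's inequality hangs both pieces on the root, and each is then
    -- compared with its branch.
    path-≤ : ∀ t {a} → Monotone a → ⟨ a , push^ H (edges t) 𝟏 ⟩ ≤ ⟨ a , rootCount H t ⟩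
    path-≤ single      mono = ≤-refl
    path-≤ (graft t s) {a} mono = begin
      ⟨ a , push^ H (suc (edges s) + edges t) 𝟏 ⟩
        ≡⟨ ⟨⟩-congʳ a (push^-+ H (suc (edges s)) (edges t) 𝟏) ⟩
      ⟨ a , push^ H (suc (edges s)) (push^ H (edges t) 𝟏) ⟩
        ≤⟨ chebyshev H (edges s) a _ (similar mono (push^𝟏-monotone (edges t))) ⟩
      ⟨ a ⊙ push^ H (suc (edges s)) 𝟏 , push^ H (edges t) 𝟏 ⟩
        ≤⟨ graft-≤ mono t s (path-≤ t) (path-≤ s) ⟩
      ⟨ a , rootCount H (graft t s) ⟩ ∎
      where open ≤-Reasoning

    -- While the root has a single child, its edge is moved into the ambient vector by adjointness,
    -- which keeps that vector strict. The first vertex with two children yields the strict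
    -- inequality; if there is none, the tree is a path hanging from its root.
    path-< : ∀ t → t ≡ pathTree (edges t) ⊎ (∀ {a} → Strict a → ⟨ a , push^ H (edges t) 𝟏 ⟩ < ⟨ a , rootCount H t ⟩)
    path-< single = inj₁ refl
    path-< (graft single s) = Sum.map
      (λ eq → trans (cong (graft single) eq) (cong (pathTree ∘ suc) (sym (+-identityʳ (edges s)))))
      (λ s> {a} (mono , 0<a , _) → begin-strict
        ⟨ a , push^ H (suc (edges s) + 0) 𝟏 ⟩
          ≡⟨ cong (λ m → ⟨ a , push^ H (suc m) 𝟏 ⟩) (+-identityʳ (edges s)) ⟩
        ⟨ a , push H (push^ H (edges s) 𝟏) ⟩         ≡⟨ push-adjoint H a _ ⟩
        ⟨ push H a , push^ H (edges s) 𝟏 ⟩           <⟨ s> (push-strict mono 0<a) ⟩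
        ⟨ push H a , rootCount H s ⟩                 ≡⟨ push-adjoint H a _ ⟨
        ⟨ a , push H (rootCount H s) ⟩               ≡⟨ ⟨⟩-congʳ a (λ c → *-identityˡ _) ⟨
        ⟨ a , 𝟏 ⊙ push H (rootCount H s) ⟩           ∎)
      (path-< s)
      where open ≤-Reasoning
    -- The branch `t` has an edge, so the vector of its path is strict as well. A walk from `bottom`
    -- to a colour `x` ranked before it supplies a pair that both vectors separate.
    path-< (graft t@(graft t′ s′) s) = inj₂ λ {a} (mono , _ , a<) →
      let mono-p , _ , p< = push^𝟏-strict (edges s′ + edges t′)
          x , x<b , 0<w   = walks-above-bottom (edges s) bottom ≤-refl
      in begin-strict
      ⟨ a , push^ H (suc (edges s) + edges t) 𝟏 ⟩
        ≡⟨ ⟨⟩-congʳ a (push^-+ H (suc (edges s)) (edges t) 𝟏) ⟩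
      ⟨ a , push^ H (suc (edges s)) (push^ H (edges t) 𝟏) ⟩
        <⟨ chebyshev-< H (edges s) a _ (similar mono mono-p) bottom x 0<w (a< x x<b) (p< x x<b) ⟩
      ⟨ a ⊙ push^ H (suc (edges s)) 𝟏 , push^ H (edges t) 𝟏 ⟩
        ≤⟨ graft-≤ mono t s (path-≤ t) (path-≤ s) ⟩
      ⟨ a , rootCount H (graft t s) ⟩ ∎
      where open ≤-Reasoning

-- Paths are trees

Adjᵛ : ∀ t → Vertex t → Vertex t → Set
Adjᵛ t x y = T (adjᵛ {t} x y)

connectedᵛ : ∀ t x → Star (Adjᵛ t) x (root t)
connectedᵛ single      x        = ε
connectedᵛ (graft t s) (inj₁ x) = gmap inj₁ id (connectedᵛ t x)
connectedᵛ (graft t s) (inj₂ y) = gmap inj₂ id (connectedᵛ s y) ◅◅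
  (subst T (adjᵛ-sym {graft t s} (inj₁ (root t)) (inj₂ (root s))) (adjᵛ-roots {t} {s}) ◅ ε)

module _ {G : Graph n} {r t} (rep : Represents G r t) where
  open Represents rep

  represents-loopless : Loopless G
  represents-loopless u = trans (adj-to u u) (adjᵛ-irrefl (to u))

  adj-from : ∀ {x y} → Adjᵛ t x y → Adj G (from x) (from y)
  adj-from {x} {y} = subst T (sym (trans (adj-to _ _) (cong₂ adjᵛ (to-from x) (to-from y))))

  represents-connected : Connected G
  represents-connected u v = subst₂ (Star (Adj G)) (from-to u) (from-to v)
    (gmap from adj-from (connectedᵛ t (to u) ◅◅ reverse (λ {x} {y} → subst T (adjᵛ-sym x y)) (connectedᵛ t (to v))))

represents-≅ : ∀ {G : Graph m} {G′ : Graph n} {r r′ t} → Represents G r t → Represents G′ r′ t → G ≅ G′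
represents-≅ R R′ =
  mk↔ₛ′ (R′.from ∘ R.to) (R.from ∘ R′.to)
    (λ u → trans (cong R′.from (R.to-from _)) (R′.from-to u))
    (λ u → trans (cong R.from (R′.to-from _)) (R.from-to u)) ,
  λ u v → trans (R.adj-to u v) (sym (trans (R′.adj-to _ _) (cong₂ adjᵛ (R′.to-from _) (R′.to-from _))))
  where
  module R  = Represents R
  module R′ = Represents R′

Consecutive : ℕ → ℕ → Set
Consecutive x y = y ≡ suc x ⊎ x ≡ suc y

path-consecutive : ∀ n {u v : Fin n} → Adj (path n) u v → Consecutive (toℕ u) (toℕ v)
path-consecutive n = Sum.map (≡ᵇ⇒≡ _ _) (≡ᵇ⇒≡ _ _) ∘ Equivalence.to Bool.T-∨

-- An injective sequence of naturals with consecutive terms never turns around.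
module _ where
  private
    tail-injective : {f : Fin (suc m) → ℕ} → Injective _≡_ _≡_ f → Injective _≡_ _≡_ (f ∘ suc)
    tail-injective inj eq with refl ← inj eq = refl

  ascending : ∀ m (f : Fin (2 + m) → ℕ) → Injective _≡_ _≡_ f →
    (∀ i → Consecutive (f (inject₁ i)) (f (suc i))) → f (suc zero) ≡ suc (f zero) →
    f (fromℕ (suc m)) ≡ suc m + f zero
  ascending zero    f inj step up = up
  ascending (suc m) f inj step up with step (suc zero)
  ... | inj₁ up′  = trans (ascending m (f ∘ suc) (tail-injective inj) (step ∘ suc) up′)
                      (trans (cong (suc m +_) up) (+-suc (suc m) (f zero)))
  ... | inj₂ down with () ← inj (suc-injective (trans (sym up) down))

  descending : ∀ m (f : Fin (2 + m) → ℕ) → Injective _≡_ _≡_ f →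
    (∀ i → Consecutive (f (inject₁ i)) (f (suc i))) → f zero ≡ suc (f (suc zero)) →
    f zero ≡ suc m + f (fromℕ (suc m))
  descending zero    f inj step down = down
  descending (suc m) f inj step down with step (suc zero)
  ... | inj₁ up with () ← inj (trans down (sym up))
  ... | inj₂ down′ = trans down (cong suc (descending m (f ∘ suc) (tail-injective inj) (step ∘ suc) down′))

far : ∀ {x y} m → x ≡ suc (suc m) + y → ¬ Consecutive x y
far {y = y} m refl (inj₁ eq) = m≢1+n+m y {suc (suc m)} eq
far {y = y} m refl (inj₂ eq) = m≢1+n+m y {m} (sym (suc-injective eq))

-- The direction of the first step persists, so the ends of the sequence are at distance at least 2
-- and the closing edge cannot exist.
path-acyclic : ∀ n → ¬ Cycle (path n)
path-acyclic n record { l = suc zero ; 2≤l = s≤s () }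
path-acyclic n record { l = suc (suc l) ; c = c ; injective = injective ; step = step ; close = close }
  with path-consecutive n (step zero)
... | inj₁ up   = far l (ascending (suc l) (toℕ ∘ c) (injective ∘ toℕ-injective) (path-consecutive n ∘ step) up)
                    (path-consecutive n close)
... | inj₂ down = far l (descending (suc l) (toℕ ∘ c) (injective ∘ toℕ-injective) (path-consecutive n ∘ step) down)
                    (Sum.swap (path-consecutive n close))

path-isTree : ∀ n → IsTree (path n)
path-isTree zero    = record
  { loopless  = λ ()
  ; connected = λ ()
  ; acyclic   = path-acyclic 0 }
path-isTree (suc m) = record
  { loopless  = represents-loopless (path-represented m)
  ; connected = represents-connected (path-represented m)
  ; acyclic   = path-acyclic (suc m) }

-- The path is the unique minimizer

PathMinimal : FiniteGraph → Set
PathMinimal (_ , H) = ∀ n → 2 ≤ n → (t : Graph n) → IsTree t → hom (path n) H ≤ hom t H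

leaf-unique : ∀ {G : Graph (suc n)} {u} → IsTree G → Leaf G u → ∀ {x y} → Adj G u x → Adj G u y → x ≡ y
leaf-unique {u = u} isTree leaf {x} {y} ux uy with punchView u x | punchView u y
... | hole    | _       = contradiction ux (irreflexive isTree)
... | punch i | hole    = contradiction uy (irreflexive isTree)
... | punch i | punch j = cong (punchIn u) (trans (unique i ux) (sym (unique j uy)))
  where open Leaf leaf

-- The roots of `s` and of `s′` are distinct neighbours of `r`, which is impossible at a leaf.
two-children : ∀ {G : Graph n} {r t s s′} → Represents G r (graft (graft t s′) s) →
               ¬ (∀ {x y} → Adj G r x → Adj G r y → x ≡ y)
two-children {G = G} {r} {t} {s} {s′} rep unique = impossible (begin
  inj₂ (root s)                     ≡⟨ to-from _ ⟨
  to (from (inj₂ (root s)))         ≡⟨ cong to (unique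
    (subst (λ x → Adj G x _) from-root (adj-from rep (adjᵛ-roots {graft t s′} {s})))
    (subst (λ x → Adj G x _) from-root (adj-from rep {inj₁ (inj₁ (root t))} (adjᵛ-roots {t} {s′})))) ⟩
  to (from (inj₁ (inj₂ (root s′)))) ≡⟨ to-from _ ⟩
  inj₁ (inj₂ (root s′))             ∎)
  where
  open Represents rep
  open ≡-Reasoning
  from-root : from (inj₁ (inj₁ (root t))) ≡ r
  from-root = trans (cong from (sym to-root)) (from-to r)
  impossible : ¬ (Vertex (graft (graft t s′) s) ∋ inj₂ (root s)) ≡ inj₁ (inj₂ (root s′))
  impossible ()

module _ (H : Graph k) {R : Ranking k} (adm : Admissible H R) where

  admissible⇒PathMinimal : PathMinimal (k , H)
  admissible⇒PathMinimal (suc m) 2≤n G isTree with represent isTree zero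
  ... | t , rep with refl ← Represents.order rep = begin
    hom (path (suc (edges t))) H    ≡⟨ hom-path H (edges t) ⟩
    ⟨ 𝟏 , push^ H (edges t) 𝟏 ⟩     ≤⟨ path-≤ H R adm t (𝟏-monotone H R) ⟩
    ⟨ 𝟏 , rootCount H t ⟩           ≡⟨ hom≡ H rep ⟨
    hom G H                         ∎
    where open ≤-Reasoning

  -- A leaf as root forces the shape `graft single s`. Either `s` is a path from its root, and then
  -- so is the whole tree, or the strict comparison for `s` against `push 𝟏` contradicts the bound.
  hom-≤-path⇒≅ : ∀ n → 2 ≤ n → (G : Graph n) → IsTree G → hom G H ≤ hom (path n) H → G ≅ path n
  hom-≤-path⇒≅ (suc zero) (s≤s ())
  hom-≤-path⇒≅ (suc (suc m)) _ G isTree G≤path with exists-leaf isTree zero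
  ... | r , _ , leaf with represent isTree r
  ...   | single , rep with () ← Represents.order rep
  ...   | graft (graft t s′) s , rep = ⊥-elim (two-children rep (leaf-unique isTree leaf))
  ...   | graft single s , rep with path-< H R adm s
  ...     | inj₁ s≡path with refl ← Represents.order rep =
    subst (λ e → G ≅ path (2 + e)) (sym (+-identityʳ (edges s)))
      (represents-≅ (subst (Represents G r) (cong (graft single) s≡path) rep) (path-represented (suc (edges s))))
  ...     | inj₂ s> = contradiction G≤path (<⇒≱ (begin-strict
    hom (path (2 + m)) H
      ≡⟨ cong (λ n → hom (path n) H)
           (trans (Represents.order rep) (cong (2 +_) (+-identityʳ (edges s)))) ⟩
    hom (path (2 + edges s)) H            ≡⟨ hom-path H (suc (edges s)) ⟩
    ⟨ 𝟏 , push H (push^ H (edges s) 𝟏) ⟩  ≡⟨ push-adjoint H 𝟏 _ ⟩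
    ⟨ push H 𝟏 , push^ H (edges s) 𝟏 ⟩    <⟨ s> (push-strict H R adm (𝟏-monotone H R) (s≤s z≤n)) ⟩
    ⟨ push H 𝟏 , rootCount H s ⟩          ≡⟨ push-adjoint H 𝟏 _ ⟨
    ⟨ 𝟏 , push H (rootCount H s) ⟩        ≡⟨ ⟨⟩-congʳ 𝟏 (λ c → *-identityˡ _) ⟨
    ⟨ 𝟏 , rootCount H (graft single s) ⟩  ≡⟨ hom≡ H rep ⟨
    hom G H                               ∎))
    where open ≤-Reasoning

  admissible⇒PathUniqueMinimizer : PathUniqueMinimizer (k , H)
  admissible⇒PathUniqueMinimizer n 2≤n =
    (path-isTree n , admissible⇒PathMinimal n 2≤n) ,
    λ t (isTree , minimal) → hom-≤-path⇒≅ n 2≤n t isTree (minimal (path n) (path-isTree n))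

-- All trees are minimizers

Regular : Graph k → Set
Regular H = ∀ c d → Adj H c d → degree H c ≡ degree H d

-- The exponent is the number of edges and is positive because n ≥ 2, so that isolated colours
-- contribute 0 and not 0 ^ 0.
regular⇒AllMinimize : ∀ (H : Graph k) e → Regular H →
  (∀ m → (∑ λ c → degree H c ^ suc m) ≡ e (2 + m)) → AllMinimize e (k , H)
regular⇒AllMinimize H e reg value n 2≤n t isTree =
  (isTree , λ t′ isTree′ → ≤-reflexive (trans (hom≡e n 2≤n t isTree) (sym (hom≡e n 2≤n t′ isTree′)))) ,
  hom≡e n 2≤n t isTree
  where
  hom≡e : ∀ n → 2 ≤ n → (G : Graph n) → IsTree G → hom G H ≡ e n
  hom≡e (suc zero) (s≤s ())
  hom≡e (suc (suc m)) _ G isTree with t , rep ← represent isTree zero = begin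
    hom G H                               ≡⟨ hom≡ H rep ⟩
    (∑ λ c → 1 * rootCount H t c)
      ≡⟨ (∑-cong λ c → trans (*-identityˡ _) (rootCount-regular H reg t c)) ⟩
    (∑ λ c → degree H c ^ edges t)
      ≡⟨ (∑-cong λ c → cong (degree H c ^_) (sym (suc-injective (Represents.order rep)))) ⟩
    (∑ λ c → degree H c ^ suc m)          ≡⟨ value m ⟩
    e (2 + m)                             ∎
    where open ≡-Reasoning

AllMinimize⇒PathMinimal : ∀ {e} H → AllMinimize e H → PathMinimal H
AllMinimize⇒PathMinimal H all n 2≤n t isTree =
  proj₂ (proj₁ (all n 2≤n (path n) (path-isTree n))) t isTree

PathUniqueMinimizer⇒PathMinimal : ∀ H → PathUniqueMinimizer H → PathMinimal H
PathUniqueMinimizer⇒PathMinimal H unique n 2≤n = proj₂ (proj₁ (unique n 2≤n))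

opaque
  unfolding ∑

  regular? : (H : Graph k) → Dec (Regular H)
  regular? H = all? λ c → all? λ d → T? (adj H c d) →-dec degree H c ℕ.≟ degree H d

  -- With `∑` unfolded the degrees of a concrete graph compute, so regularity is decided by
  -- evaluation and what remains is an identity in `m`.
  all-minimize : ∀ (H : FiniteGraph) {e} {reg : True (regular? (proj₂ H))} →
                 (∀ m → (∑ λ c → degree (proj₂ H) c ^ suc m) ≡ e (2 + m)) → AllMinimize e H
  all-minimize (_ , H) {reg = reg} = regular⇒AllMinimize H _ (toWitness reg)

  minimizers-0 : All (AllMinimize (λ n → 0)) (H₁ ∷ H₃ ∷ H₉ ∷ [])
  minimizers-0 = all-minimize H₁ (λ m → refl) ∷ all-minimize H₃ (λ m → refl) ∷ all-minimize H₉ (λ m → refl) ∷ []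

  minimizers-1 : All (AllMinimize (λ n → 1)) (H₂ ∷ H₄ ∷ H₁₀ ∷ [])
  minimizers-1 = all-minimize H₂ one ∷ all-minimize H₄ one ∷ all-minimize H₁₀ one ∷ []
    where
    one : ∀ m → 1 ^ suc m + 0 ≡ 1
    one m rewrite ^-zeroˡ m = refl

  minimizers-2 : All (AllMinimize (λ n → 2)) (H₅ ∷ H₆ ∷ H₁₁ ∷ H₁₃ ∷ [])
  minimizers-2 = all-minimize H₅ two ∷ all-minimize H₆ two ∷ all-minimize H₁₁ two ∷ all-minimize H₁₃ two ∷ []
    where
    two : ∀ m → 1 ^ suc m + (1 ^ suc m + 0) ≡ 2
    two m rewrite ^-zeroˡ m = refl

  minimizers-3 : All (AllMinimize (λ n → 3)) (H₁₂ ∷ H₁₄ ∷ [])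
  minimizers-3 = all-minimize H₁₂ three ∷ all-minimize H₁₄ three ∷ []
    where
    three : ∀ m → 1 ^ suc m + (1 ^ suc m + (1 ^ suc m + 0)) ≡ 3
    three m rewrite ^-zeroˡ m = refl

  minimizers-2ⁿ : All (AllMinimize (λ n → 2 ^ n)) (H₈ ∷ H₁₇ ∷ [])
  minimizers-2ⁿ = all-minimize H₈ (λ m → refl) ∷ all-minimize H₁₇ (λ m → refl) ∷ []

  minimizers-2ⁿ+1 : All (AllMinimize (λ n → 2 ^ n + 1)) (H₁₈ ∷ [])
  minimizers-2ⁿ+1 = all-minimize H₁₈ value ∷ []
    where
    identity : ∀ x → x + (x + 1) ≡ 2 * x + 1
    identity = solve-∀
    value : ∀ m → 2 ^ suc m + (2 ^ suc m + (1 ^ suc m + 0)) ≡ 2 ^ (2 + m) + 1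
    value m rewrite ^-zeroˡ m = identity (2 ^ suc m)

  minimizers-3·2ⁿ⁻¹ : All (AllMinimize (λ n → 3 * 2 ^ (n ∸ 1))) (H₂₃ ∷ H₂₅ ∷ [])
  minimizers-3·2ⁿ⁻¹ = all-minimize H₂₃ (λ m → refl) ∷ all-minimize H₂₅ (λ m → refl) ∷ []

  minimizers-3ⁿ : All (AllMinimize (λ n → 3 ^ n)) (H₂₈ ∷ [])
  minimizers-3ⁿ = all-minimize H₂₈ (λ m → refl) ∷ []

path-unique : ∀ (H : FiniteGraph) rank bottom {adm : True (admissible? (proj₂ H) (ranking (lookup rank) bottom))} →
              PathUniqueMinimizer H
path-unique (_ , H) _ _ {adm} = admissible⇒PathUniqueMinimizer H (toWitness adm)

-- The ranks follow decreasing degree, ties being broken by the ranks of the neighbours; symmetric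
-- colours share a rank. In `H₁₅` and `H₁₆` the colour 3 is a component of its own and is ranked
-- after `bottom`.
path-unique-minimizers :
  All PathUniqueMinimizer (H₇ ∷ H₁₅ ∷ H₁₆ ∷ H₂₀ ∷ H₂₁ ∷ H₂₂ ∷ H₂₄ ∷ H₂₆ ∷ H₂₇ ∷ [])
path-unique-minimizers =
  path-unique H₇  (1 ∷ 0 ∷ [])     0F ∷
  path-unique H₁₅ (0 ∷ 1 ∷ 2 ∷ []) 1F ∷
  path-unique H₁₆ (0 ∷ 1 ∷ 2 ∷ []) 1F ∷
  path-unique H₂₀ (0 ∷ 1 ∷ 2 ∷ []) 2F ∷
  path-unique H₂₁ (1 ∷ 0 ∷ 1 ∷ []) 0F ∷
  path-unique H₂₂ (2 ∷ 0 ∷ 1 ∷ []) 0F ∷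
  path-unique H₂₄ (1 ∷ 0 ∷ 1 ∷ []) 0F ∷
  path-unique H₂₆ (0 ∷ 1 ∷ 1 ∷ []) 1F ∷
  path-unique H₂₇ (0 ∷ 0 ∷ 1 ∷ []) 2F ∷ []

-- Bipartitions of trees

bipartition : ∀ (G : Graph n) {X : Subset n} → (∀ u v → Adj G u v → lookup X u ≡ not (lookup X v)) →
              IsBipartition G X
bipartition G {X} alternates u v uv with lookup X u in eqᵤ | lookup X v in eqᵥ | alternates u v uv
... | true  | false | _ = inj₁ (lookup⇒[]= u X eqᵤ , λ v∈X → contradiction (trans (sym ([]=⇒lookup v∈X)) eqᵥ) λ ())
... | false | true  | _ = inj₂ ((λ u∈X → contradiction (trans (sym ([]=⇒lookup u∈X)) eqᵤ) λ ()) , lookup⇒[]= v X eqᵥ)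

alternates : ∀ (G : Graph n) {X : Subset n} → IsBipartition G X → ∀ u v → Adj G u v → lookup X u ≡ not (lookup X v)
alternates G {X} bip u v uv with bip u v uv
... | inj₁ (u∈X , v∉X) = trans ([]=⇒lookup u∈X) (sym (cong not (Bool.¬-not (v∉X ∘ lookup⇒[]= v X))))
... | inj₂ (u∉X , v∈X) = trans (Bool.¬-not (u∉X ∘ lookup⇒[]= u X)) (sym (cong not ([]=⇒lookup v∈X)))

evenDepth : ∀ {t} → Vertex t → Bool
evenDepth {single}    _        = true
evenDepth {graft t s} (inj₁ x) = evenDepth x
evenDepth {graft t s} (inj₂ y) = not (evenDepth y)

evenDepth-root : ∀ t → evenDepth (root t) ≡ true
evenDepth-root single      = refl
evenDepth-root (graft t s) = evenDepth-root t

evenDepth-alternates : ∀ {t} (x y : Vertex t) → T (adjᵛ x y) → evenDepth x ≡ not (evenDepth y)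
evenDepth-alternates {graft t s} (inj₁ x) (inj₁ y) xy = evenDepth-alternates x y xy
evenDepth-alternates {graft t s} (inj₂ x) (inj₂ y) xy = cong not (evenDepth-alternates x y xy)
evenDepth-alternates {graft t s} (inj₁ x) (inj₂ y) xy with refl , refl ← adjᵛ-graft⇒roots {x = x} {y} xy =
  trans (evenDepth-root t) (sym (cong (not ∘ not) (evenDepth-root s)))
evenDepth-alternates {graft t s} (inj₂ y) (inj₁ x) xy with refl , refl ← adjᵛ-graft⇒roots {x = x} {y} xy =
  cong not (trans (evenDepth-root s) (sym (evenDepth-root t)))

tree-bipartite : ∀ (G : Graph (suc n)) → IsTree G → ∃ (IsBipartition G)
tree-bipartite G isTree with t , rep ← represent isTree zero =
  let open Represents rep
      X = tabulate (evenDepth ∘ to)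
  in X , bipartition G λ u v uv → begin
    lookup X u        ≡⟨ lookup∘tabulate (evenDepth ∘ to) u ⟩
    evenDepth (to u)     ≡⟨ evenDepth-alternates (to u) (to v) (subst T (adj-to u v) uv) ⟩
    not (evenDepth (to v)) ≡⟨ cong not (lookup∘tabulate (evenDepth ∘ to) v) ⟨
    not (lookup X v)  ∎
  where open ≡-Reasoning

-- The H₁₉-colourings of a connected bipartite graph

centre : Fin 3 → Bool
centre 0F = false
centre 1F = true
centre 2F = false

-- `H₁₉` is complete bipartite with classes {2} and {1, 3}, so adjacency depends only on which
-- colours are the centre.
adj-H₁₉ : ∀ c d → adj (proj₂ H₁₉) c d ≡ centre c xor centre d
adj-H₁₉ 0F 0F = refl
adj-H₁₉ 0F 1F = refl
adj-H₁₉ 0F 2F = refl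
adj-H₁₉ 1F 0F = refl
adj-H₁₉ 1F 1F = refl
adj-H₁₉ 1F 2F = refl
adj-H₁₉ 2F 0F = refl
adj-H₁₉ 2F 1F = refl
adj-H₁₉ 2F 2F = refl

-- fits X f is 1 if f gives the centre exactly to the vertices outside X, and 0 otherwise.
fits : Subset n → (Fin n → Fin 3) → ℕ
fits []      f = 1
fits (b ∷ X) f = (if b xor centre (f zero) then 1 else 0) * fits X (f ∘ suc)

-- A vertex in `X` has two non-central colours to choose from, a vertex outside `X` only the centre.
sumMaps-fits : ∀ (X : Subset n) → sumMaps n (fits X) ≡ 2 ^ ∣ X ∣
sumMaps-fits []      = refl
sumMaps-fits {suc n} (b ∷ X) = begin
  (∑ λ c → sumMaps n λ f → (if b xor centre c then 1 else 0) * fits X f)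
    ≡⟨ (∑-cong λ c → sumMaps-*ˡ n (if b xor centre c then 1 else 0) (fits X)) ⟨
  (∑ λ c → (if b xor centre c then 1 else 0) * sumMaps n (fits X))
    ≡⟨ ∑-*ʳ (sumMaps n (fits X)) _ ⟨
  (∑ λ c → if b xor centre c then 1 else 0) * sumMaps n (fits X)
    ≡⟨ cong₂ _*_ (options b) (sumMaps-fits X) ⟩
  (if b then 2 else 1) * 2 ^ ∣ X ∣
    ≡⟨ power b ⟩
  2 ^ ∣ b ∷ X ∣ ∎
  where
  open ≡-Reasoning
  options : ∀ b → (∑ λ c → if b xor centre c then 1 else 0) ≡ (if b then 2 else 1)
  options true  = ∑≡sum _
  options false = ∑≡sum _
  power : ∀ b → (if b then 2 else 1) * 2 ^ ∣ X ∣ ≡ 2 ^ ∣ b ∷ X ∣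
  power true  = refl
  power false = *-identityˡ _

fits-01 : ∀ (X : Subset n) f →
          (fits X f ≡ 1 × ∀ v → lookup X v xor centre (f v) ≡ true) ⊎
          (fits X f ≡ 0 × ∃ λ v → lookup X v xor centre (f v) ≡ false)
fits-01 []      f = inj₁ (refl , λ ())
fits-01 (b ∷ X) f with b xor centre (f zero) in eq | fits-01 X (f ∘ suc)
... | false | _                  = inj₂ (refl , zero , eq)
... | true  | inj₁ (eq′ , all)   = inj₁ (trans (*-identityˡ _) eq′ , λ { zero → eq ; (suc v) → all v })
... | true  | inj₂ (eq′ , v , p) = inj₂ (trans (*-identityˡ _) eq′ , suc v , p)

xor-true : ∀ x y → T (x xor y) → x ≡ not y
xor-true true  false _ = refl
xor-true false true  _ = refl

xor-true⁻ : ∀ {x y} → x ≡ not y → T (x xor y)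
xor-true⁻ {y = true}  refl = tt
xor-true⁻ {y = false} refl = tt

module _ (G : Graph (suc n)) (connected : Connected G) {X : Subset (suc n)} (bip : IsBipartition G X) where

  private
    side : (Fin (suc n) → Fin 3) → Fin (suc n) → Bool
    side f v = lookup X v xor centre (f v)

    side-∁ : ∀ f v → lookup (∁ X) v xor centre (f v) ≡ not (side f v)
    side-∁ f v = trans (cong (_xor centre (f v)) (lookup-map v not X))
      (sym (Bool.not-distribˡ-xor (lookup X v) (centre (f v))))

    -- Along an edge both membership in `X` and being coloured by the centre change, so their xor
    -- does not.
    side-constant : ∀ f → IsColoring G (proj₂ H₁₉) f → ∀ {u v} → Star (Adj G) u v → side f u ≡ side f v
    side-constant f col ε = refl
    side-constant f col {u} (_◅_ {j = v} uv walk) = trans (begin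
      lookup X u xor centre (f u)
        ≡⟨ cong₂ _xor_ (alternates G bip u v uv) (xor-true _ _ (subst T (adj-H₁₉ (f u) (f v)) (col u v uv))) ⟩
      not (lookup X v) xor not (centre (f v)) ≡⟨ Bool.not-distribˡ-xor (lookup X v) _ ⟨
      not (lookup X v xor not (centre (f v))) ≡⟨ cong not (Bool.not-distribʳ-xor (lookup X v) _) ⟨
      not (not (side f v))                    ≡⟨ Bool.not-involutive _ ⟩
      side f v                                ∎) (side-constant f col walk)
      where open ≡-Reasoning

    constant⇒colouring : ∀ f b → (∀ v → side f v ≡ b) → IsColoring G (proj₂ H₁₉) f
    constant⇒colouring f b const u v uv = subst T (sym (adj-H₁₉ (f u) (f v)))
      (xor-true⁻ (flip (lookup X u) (lookup X v) (alternates G bip u v uv) (trans (const u) (sym (const v)))))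
      where
      flip : ∀ x y {c d} → x ≡ not y → x xor c ≡ y xor d → c ≡ not d
      flip true  false refl eq = trans (sym (Bool.not-involutive _)) (cong not eq)
      flip false true  refl eq = eq

    -- In a colouring one class of the bipartition receives the centre throughout and the other
    -- nowhere. Both indicators cannot be 1, as the vertex `zero` shows; if both are 0, then `side`
    -- is not constant.
    split : ∀ f → ⟦ isColoring? G (proj₂ H₁₉) f ⟧ ≡ fits X f + fits (∁ X) f
    split f with fits-01 X f | fits-01 (∁ X) f
    ... | inj₁ (eq , all) | inj₁ (eq′ , all′) =
      contradiction (trans (sym (all′ zero)) (trans (side-∁ f zero) (cong not (all zero)))) λ ()
    ... | inj₁ (eq , all) | inj₂ (eq′ , _) =
      trans (⟦⟧-true (isColoring? G (proj₂ H₁₉) f) (constant⇒colouring f true all)) (sym (cong₂ _+_ eq eq′))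
    ... | inj₂ (eq , _) | inj₁ (eq′ , all′) =
      trans (⟦⟧-true (isColoring? G (proj₂ H₁₉) f) (constant⇒colouring f false λ v →
        trans (sym (Bool.not-involutive _)) (cong not (trans (sym (side-∁ f v)) (all′ v)))))
        (sym (cong₂ _+_ eq eq′))
    ... | inj₂ (eq , u , p) | inj₂ (eq′ , v , q) =
      trans (⟦⟧-false (isColoring? G (proj₂ H₁₉) f) λ col →
        contradiction (trans (sym q) (trans (side-∁ f v)
          (cong not (trans (side-constant f col (connected v u)) p)))) λ ())
        (sym (cong₂ _+_ eq eq′))

  hom-H₁₉ : hom G (proj₂ H₁₉) ≡ 2 ^ ∣ X ∣ + 2 ^ ∣ ∁ X ∣
  hom-H₁₉ = begin
    hom G (proj₂ H₁₉)                                        ≡⟨ hom≡sumMaps G (proj₂ H₁₉) ⟩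
    (sumMaps (suc n) λ f → ⟦ isColoring? G (proj₂ H₁₉) f ⟧)  ≡⟨ sumMaps-cong (suc n) split ⟩
    (sumMaps (suc n) λ f → fits X f + fits (∁ X) f)          ≡⟨ sumMaps-+ (suc n) (fits X) (fits (∁ X)) ⟩
    sumMaps (suc n) (fits X) + sumMaps (suc n) (fits (∁ X))
      ≡⟨ cong₂ _+_ (sumMaps-fits X) (sumMaps-fits (∁ X)) ⟩
    2 ^ ∣ X ∣ + 2 ^ ∣ ∁ X ∣                                  ∎
    where open ≡-Reasoning

-- Balanced bipartitions

balancedValue : ℕ → ℕ
balancedValue n = 2 ^ ⌊ n /2⌋ + 2 ^ ⌈ n /2⌉

Balanced : ℕ → ℕ → ℕ → Set
Balanced n a b = (2 ∣ n → a ≡ b) × (¬ 2 ∣ n → ∣ a - b ∣ ≡ 1)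

parity-of-halves : ∀ n → (2 ∣ n × ⌈ n /2⌉ ≡ ⌊ n /2⌋) ⊎ (¬ 2 ∣ n × ⌈ n /2⌉ ≡ suc ⌊ n /2⌋)
parity-of-halves zero          = inj₁ (divides 0 refl , refl)
parity-of-halves (suc zero)    = inj₂ ((λ 2∣1 → contradiction (∣1⇒≡1 2∣1) λ ()) , refl)
parity-of-halves (suc (suc n)) with parity-of-halves n
... | inj₁ (divides q eq , eq′) = inj₁ (divides (suc q) (cong (2 +_) eq) , cong suc eq′)
... | inj₂ (¬2∣n , eq)          = inj₂ ((λ 2∣2+n → ¬2∣n (∣m+n∣m⇒∣n 2∣2+n (divides 1 refl))) , cong suc eq)

double-injective : ∀ {a b} → a + a ≡ b + b → a ≡ b
double-injective {a} {b} eq = trans (n≡⌊n+n/2⌋ a) (trans (cong ⌊_/2⌋ eq) (sym (n≡⌊n+n/2⌋ b)))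

∣-∣≡1 : ∀ a b → ∣ a - b ∣ ≡ 1 → a ≡ suc b ⊎ b ≡ suc a
∣-∣≡1 zero          (suc zero)    refl = inj₂ refl
∣-∣≡1 (suc zero)    zero          refl = inj₁ refl
∣-∣≡1 (suc a)       (suc b)       eq   = Sum.map (cong suc) (cong suc) (∣-∣≡1 a b eq)

suc-halves : ∀ {b n} → ⌈ n /2⌉ ≡ suc ⌊ n /2⌋ → b + suc b ≡ n → b ≡ ⌊ n /2⌋
suc-halves {b} {n} odd sum = double-injective (suc-injective (begin
  suc (b + b)                     ≡⟨ +-suc b b ⟨
  b + suc b                       ≡⟨ sum ⟩
  n                               ≡⟨ ⌊n/2⌋+⌈n/2⌉≡n n ⟨
  ⌊ n /2⌋ + ⌈ n /2⌉               ≡⟨ cong (⌊ n /2⌋ +_) odd ⟩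
  ⌊ n /2⌋ + suc ⌊ n /2⌋           ≡⟨ +-suc _ _ ⟩
  suc (⌊ n /2⌋ + ⌊ n /2⌋)         ∎))
  where open ≡-Reasoning

balanced⇒value : ∀ {n a b} → a + b ≡ n → Balanced n a b → 2 ^ a + 2 ^ b ≡ balancedValue n
balanced⇒value {n} {a} {b} sum (even , odd) with parity-of-halves n
... | inj₁ (2∣n , ceil) with refl ← even 2∣n
                        with refl ← double-injective {a} {⌊ n /2⌋}
                          (trans sum (trans (sym (⌊n/2⌋+⌈n/2⌉≡n n)) (cong (⌊ n /2⌋ +_) ceil))) =
  cong (λ c → 2 ^ ⌊ n /2⌋ + 2 ^ c) (sym ceil)
... | inj₂ (¬2∣n , ceil) with ∣-∣≡1 a b (odd ¬2∣n)
...   | inj₁ refl with refl ← suc-halves {b} {n} ceil (trans (+-comm b (suc b)) sum) =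
  trans (+-comm (2 ^ suc b) _) (cong (λ c → 2 ^ b + 2 ^ c) (sym ceil))
...   | inj₂ refl with refl ← suc-halves {a} {n} ceil sum = cong (λ c → 2 ^ a + 2 ^ c) (sym ceil)

module _ {n a b} (sum : a + b ≡ n) where

  -- As a exceeds ⌈n/2⌉, the power 2 ^ a alone is at least 2 · 2 ^ ⌈n/2⌉ and so reaches the balanced
  -- value; the positive term 2 ^ b makes the inequality strict.
  unbalanced⇒larger : ⌈ n /2⌉ < a → balancedValue n < 2 ^ a + 2 ^ b
  unbalanced⇒larger c<a = begin-strict
    2 ^ ⌊ n /2⌋ + 2 ^ ⌈ n /2⌉ ≤⟨ +-monoˡ-≤ _ (^-monoʳ-≤ 2 (⌊n/2⌋≤⌈n/2⌉ n)) ⟩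
    2 ^ ⌈ n /2⌉ + 2 ^ ⌈ n /2⌉ ≡⟨ cong (2 ^ ⌈ n /2⌉ +_) (+-identityʳ _) ⟨
    2 ^ suc ⌈ n /2⌉           ≤⟨ ^-monoʳ-≤ 2 c<a ⟩
    2 ^ a                     <⟨ m<m+n (2 ^ a) (m^n>0 2 b) ⟩
    2 ^ a + 2 ^ b             ∎
    where open ≤-Reasoning

  ⌊n/2⌋≤ : b ≤ ⌈ n /2⌉ → ⌊ n /2⌋ ≤ a
  ⌊n/2⌋≤ b≤c = +-cancelʳ-≤ ⌈ n /2⌉ _ _ (begin
    ⌊ n /2⌋ + ⌈ n /2⌉ ≡⟨ ⌊n/2⌋+⌈n/2⌉≡n n ⟩
    n                 ≡⟨ sum ⟨
    a + b             ≤⟨ +-monoʳ-≤ a b≤c ⟩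
    a + ⌈ n /2⌉       ∎)
    where open ≤-Reasoning

-- If neither part exceeds ⌈n/2⌉, then both are at least ⌊n/2⌋, which leaves only the balanced
-- sizes.
balanced-or-larger : ∀ {n a b} → a + b ≡ n → Balanced n a b ⊎ balancedValue n < 2 ^ a + 2 ^ b
balanced-or-larger {n} {a} {b} sum with a ≤? ⌈ n /2⌉ | b ≤? ⌈ n /2⌉
... | no a≰  | _      = inj₂ (unbalanced⇒larger sum (≰⇒> a≰))
... | yes _  | no b≰  = inj₂ (subst (balancedValue n <_) (+-comm (2 ^ b) _)
                          (unbalanced⇒larger (trans (+-comm b a) sum) (≰⇒> b≰)))
... | yes a≤ | yes b≤ = inj₁ balanced
  where
  ⌊⌋≤a = ⌊n/2⌋≤ sum b≤
  ⌊⌋≤b = ⌊n/2⌋≤ (trans (+-comm b a) sum) a≤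
  balanced : Balanced n a b
  balanced with parity-of-halves n
  ... | inj₁ (2∣n , ceil) =
    (λ _ → trans (≤-antisym (subst (a ≤_) ceil a≤) ⌊⌋≤a) (≤-antisym ⌊⌋≤b (subst (b ≤_) ceil b≤))) ,
    λ ¬2∣n → contradiction 2∣n ¬2∣n
  ... | inj₂ (¬2∣n , ceil) = (λ 2∣n → contradiction 2∣n ¬2∣n) , λ _ → odd (m≤n⇒m<n∨m≡n ⌊⌋≤a)
    where
    sum′ : a + b ≡ ⌊ n /2⌋ + suc ⌊ n /2⌋
    sum′ = trans sum (trans (sym (⌊n/2⌋+⌈n/2⌉≡n n)) (cong (⌊ n /2⌋ +_) ceil))
    odd : ⌊ n /2⌋ < a ⊎ ⌊ n /2⌋ ≡ a → ∣ a - b ∣ ≡ 1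
    odd (inj₁ f<a) with a≡ ← ≤-antisym (subst (a ≤_) ceil a≤) f<a = begin
      ∣ a - b ∣                         ≡⟨ cong₂ ∣_-_∣ a≡ (+-cancelˡ-≡ (suc ⌊ n /2⌋) b ⌊ n /2⌋
        (trans (cong (_+ b) (sym a≡)) (trans sum′ (+-suc _ _)))) ⟩
      ∣ suc ⌊ n /2⌋ - ⌊ n /2⌋ ∣         ≡⟨ cong (λ x → ∣ x - ⌊ n /2⌋ ∣) (+-comm 1 ⌊ n /2⌋) ⟩
      ∣ ⌊ n /2⌋ + 1 - ⌊ n /2⌋ ∣         ≡⟨ ∣m+n-m∣≡n ⌊ n /2⌋ 1 ⟩
      1                                 ∎
      where
      open ≡-Reasoning
      ∣m+n-m∣≡n : ∀ m n → ∣ m + n - m ∣ ≡ n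
      ∣m+n-m∣≡n m n = trans (∣-∣-comm (m + n) m) (∣m-m+n∣≡n m n)
    odd (inj₂ f≡a) = begin
      ∣ a - b ∣                         ≡⟨ cong₂ ∣_-_∣ (sym f≡a) (+-cancelˡ-≡ ⌊ n /2⌋ b (suc ⌊ n /2⌋)
        (trans (cong (_+ b) f≡a) sum′)) ⟩
      ∣ ⌊ n /2⌋ - suc ⌊ n /2⌋ ∣         ≡⟨ cong ∣ ⌊ n /2⌋ -_∣ (+-comm 1 ⌊ n /2⌋) ⟩
      ∣ ⌊ n /2⌋ - (⌊ n /2⌋ + 1) ∣       ≡⟨ ∣m-m+n∣≡n ⌊ n /2⌋ 1 ⟩
      1                                 ∎
      where open ≡-Reasoning

-- The minimizers for H₁₉

opaque
  unfolding ∑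

  push-H₁₉ : ∀ a c → push (proj₂ H₁₉) a c ≡ (if centre c then a 0F + a 2F else a 1F)
  push-H₁₉ a 0F = trans (+-identityʳ _) (+-identityʳ (a 1F))
  push-H₁₉ a 1F = cong₂ _+_ (+-identityʳ (a 0F)) (trans (+-identityʳ _) (+-identityʳ (a 2F)))
  push-H₁₉ a 2F = trans (+-identityʳ _) (+-identityʳ (a 1F))

  ∑-three : (f : Fin 3 → ℕ) → ∑ f ≡ f 0F + f 2F + f 1F
  ∑-three f = trans (cong (λ x → f 0F + (f 1F + x)) (+-identityʳ (f 2F)))
    (trans (cong (f 0F +_) (+-comm (f 1F) (f 2F))) (sym (+-assoc (f 0F) (f 2F) (f 1F))))

-- The centre adds up two equal values while the other colours copy the value at the centre, so
-- every second step doubles.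
push^-H₁₉ : ∀ m c → push^ (proj₂ H₁₉) m 𝟏 c ≡ (if centre c then 2 ^ ⌈ m /2⌉ else 2 ^ ⌊ m /2⌋)
push^-H₁₉ zero    0F = refl
push^-H₁₉ zero    1F = refl
push^-H₁₉ zero    2F = refl
push^-H₁₉ (suc m) 0F = trans (push-H₁₉ _ 0F) (push^-H₁₉ m 1F)
push^-H₁₉ (suc m) 1F = trans (push-H₁₉ _ 1F) (trans (cong₂ _+_ (push^-H₁₉ m 0F) (push^-H₁₉ m 2F))
  (cong (2 ^ ⌊ m /2⌋ +_) (sym (+-identityʳ _))))
push^-H₁₉ (suc m) 2F = trans (push-H₁₉ _ 2F) (push^-H₁₉ m 1F)

hom-path-H₁₉ : ∀ m → hom (path (suc m)) (proj₂ H₁₉) ≡ balancedValue (suc m)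
hom-path-H₁₉ m = begin
  hom (path (suc m)) (proj₂ H₁₉)              ≡⟨ hom-path (proj₂ H₁₉) m ⟩
  ⟨ 𝟏 , push^ (proj₂ H₁₉) m 𝟏 ⟩               ≡⟨ (∑-cong λ c → *-identityˡ _) ⟩
  ∑ (push^ (proj₂ H₁₉) m 𝟏)                   ≡⟨ ∑-three _ ⟩
  _
    ≡⟨ cong₂ _+_ (cong₂ _+_ (push^-H₁₉ m 0F) (push^-H₁₉ m 2F)) (push^-H₁₉ m 1F) ⟩
  2 ^ ⌊ m /2⌋ + 2 ^ ⌊ m /2⌋ + 2 ^ ⌈ m /2⌉     ≡⟨ +-comm _ (2 ^ ⌈ m /2⌉) ⟩
  -- By computation ⌊ suc m /2⌋ is ⌈ m /2⌉ and ⌈ suc m /2⌉ is suc ⌊ m /2⌋, so the two equal powers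
  -- merge into the second term.
  2 ^ ⌈ m /2⌉ + (2 ^ ⌊ m /2⌋ + 2 ^ ⌊ m /2⌋)
    ≡⟨ cong (λ x → 2 ^ ⌈ m /2⌉ + (2 ^ ⌊ m /2⌋ + x)) (+-identityʳ _) ⟨
  balancedValue (suc m)                       ∎
  where open ≡-Reasoning

∣X∣+∣∁X∣≡n : ∀ (X : Subset n) → ∣ X ∣ + ∣ ∁ X ∣ ≡ n
∣X∣+∣∁X∣≡n X = trans (cong (∣ X ∣ +_) (∣∁p∣≡n∸∣p∣ X)) (m+[n∸m]≡n (∣p∣≤n X))

value-≤-hom : ∀ (G : Graph (suc n)) → IsTree G → balancedValue (suc n) ≤ hom G (proj₂ H₁₉)
value-≤-hom {n} G isTree = let X , bip = tree-bipartite G isTree in begin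
  balancedValue (suc n)    ≤⟨ [ ≤-reflexive ∘ sym ∘ balanced⇒value {a = ∣ X ∣} (∣X∣+∣∁X∣≡n X) , <⇒≤ ]′
                                (balanced-or-larger (∣X∣+∣∁X∣≡n X)) ⟩
  2 ^ ∣ X ∣ + 2 ^ ∣ ∁ X ∣  ≡⟨ hom-H₁₉ G (IsTree.connected isTree) bip ⟨
  hom G (proj₂ H₁₉)        ∎
  where open ≤-Reasoning

H₁₉-PathMinimal : PathMinimal H₁₉
H₁₉-PathMinimal (suc m) _ t isTree = ≤-trans (≤-reflexive (hom-path-H₁₉ m)) (value-≤-hom t isTree)

-- The path attains the lower bound `balancedValue`, so minimizing means attaining it. `hom-H₁₉`
-- holds for every bipartition and thus applies to the given balanced one.
H₁₉-minimizers : ∀ n → 2 ≤ n → (t : Graph n) → IsTree t → IsMinimizer (proj₂ H₁₉) t ⇔ HasBalancedBipartition t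
H₁₉-minimizers (suc m) _ t isTree = mk⇔ balanced minimizer
  where
  balanced : IsMinimizer (proj₂ H₁₉) t → HasBalancedBipartition t
  balanced (_ , minimal) =
    let X , bip = tree-bipartite t isTree
        not-larger = ≤⇒≯ (begin
          2 ^ ∣ X ∣ + 2 ^ ∣ ∁ X ∣        ≡⟨ hom-H₁₉ t (IsTree.connected isTree) bip ⟨
          hom t (proj₂ H₁₉)              ≤⟨ minimal (path (suc m)) (path-isTree (suc m)) ⟩
          hom (path (suc m)) (proj₂ H₁₉) ≡⟨ hom-path-H₁₉ m ⟩
          balancedValue (suc m)          ∎)
    in X , bip , [ id , (λ larger → contradiction larger not-larger) ]′ (balanced-or-larger (∣X∣+∣∁X∣≡n X))
    where open ≤-Reasoning

  minimizer : HasBalancedBipartition t → IsMinimizer (proj₂ H₁₉) t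
  minimizer (X , bip , balanced) = isTree , λ t′ isTree′ → ≤-trans
    (≤-reflexive (trans (hom-H₁₉ t (IsTree.connected isTree) bip)
      (balanced⇒value {a = ∣ X ∣} (∣X∣+∣∁X∣≡n X) balanced)))
    (value-≤-hom t′ isTree′)

graph : ∀ i → Graph (proj₁ (lookup catalogue i))
graph i = proj₂ (lookup catalogue i)

catalogue-sizes : ∀ (i : Fin 28) → 1 ≤ proj₁ (lookup catalogue i) × proj₁ (lookup catalogue i) ≤ 3
catalogue-sizes = from-yes (all? λ i → 1 ≤? proj₁ (lookup catalogue i) ×-dec proj₁ (lookup catalogue i) ≤? 3)

-- The catalogue is complete

allBool? : ∀ {P : Bool → Set} → Decidable P → Dec (∀ b → P b)
allBool? P? = map′ (λ (f , t) → λ { false → f ; true → t }) (λ p → p false , p true) (P? false ×-dec P? true)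

-- All bijections between vertex sets of equal size up to three are listed, which turns the search
-- for an isomorphism into a finite one.
permutations : ∀ k j → List (Permutation k j)
permutations 1 1 = idₚ ∷ []
permutations 2 2 = idₚ ∷ transpose 0F 1F ∷ []
permutations 3 3 = idₚ ∷ transpose 0F 1F ∷ transpose 0F 2F ∷ transpose 1F 2F ∷
                   transpose 0F 1F ∘ₚ transpose 1F 2F ∷ transpose 1F 2F ∘ₚ transpose 0F 1F ∷ []
permutations _ _ = []

Matrix : ℕ → Set
Matrix k = Fin k → Fin k → Bool

Catalogued : Matrix k → Set
Catalogued {k} a = ∃ λ i →
  Any (λ σ → ∀ u v → a u v ≡ adj (graph i) (σ ⟨$⟩ʳ u) (σ ⟨$⟩ʳ v)) (permutations k _)

catalogued? : (a : Matrix k) → Dec (Catalogued a)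
catalogued? a = any? λ i → Any.any? (λ σ → all? λ u → all? λ v → a u v Bool.≟ _) _

-- A symmetric matrix is given by its entries on and above the diagonal, so completeness comes down
-- to 2, 8 and 64 cases.
matrix₁ : Bool → Matrix 1
matrix₁ l₁ _ _ = l₁

matrix₂ : Bool → Bool → Bool → Matrix 2
matrix₂ l₁ l₂ e 0F 0F = l₁
matrix₂ l₁ l₂ e 1F 1F = l₂
matrix₂ l₁ l₂ e _  _  = e

matrix₃ : Bool → Bool → Bool → Bool → Bool → Bool → Matrix 3
matrix₃ l₁ l₂ l₃ e₁₂ e₁₃ e₂₃ 0F 0F = l₁
matrix₃ l₁ l₂ l₃ e₁₂ e₁₃ e₂₃ 1F 1F = l₂
matrix₃ l₁ l₂ l₃ e₁₂ e₁₃ e₂₃ 2F 2F = l₃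
matrix₃ l₁ l₂ l₃ e₁₂ e₁₃ e₂₃ 0F 1F = e₁₂
matrix₃ l₁ l₂ l₃ e₁₂ e₁₃ e₂₃ 1F 0F = e₁₂
matrix₃ l₁ l₂ l₃ e₁₂ e₁₃ e₂₃ 0F 2F = e₁₃
matrix₃ l₁ l₂ l₃ e₁₂ e₁₃ e₂₃ 2F 0F = e₁₃
matrix₃ l₁ l₂ l₃ e₁₂ e₁₃ e₂₃ 1F 2F = e₂₃
matrix₃ l₁ l₂ l₃ e₁₂ e₁₃ e₂₃ 2F 1F = e₂₃

catalogued₁ : ∀ l₁ → Catalogued (matrix₁ l₁)
catalogued₁ = from-yes (allBool? λ l₁ → catalogued? (matrix₁ l₁))

catalogued₂ : ∀ l₁ l₂ e → Catalogued (matrix₂ l₁ l₂ e)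
catalogued₂ = from-yes (allBool? λ l₁ → allBool? λ l₂ → allBool? λ e → catalogued? (matrix₂ l₁ l₂ e))

catalogued₃ : ∀ l₁ l₂ l₃ e₁₂ e₁₃ e₂₃ → Catalogued (matrix₃ l₁ l₂ l₃ e₁₂ e₁₃ e₂₃)
catalogued₃ = from-yes (allBool? λ l₁ → allBool? λ l₂ → allBool? λ l₃ →
  allBool? λ e₁₂ → allBool? λ e₁₃ → allBool? λ e₂₃ → catalogued? (matrix₃ l₁ l₂ l₃ e₁₂ e₁₃ e₂₃))

catalogued⇒≅ : ∀ (G : Graph k) {a} → (∀ u v → adj G u v ≡ a u v) → Catalogued a → ∃ λ i → G ≅ graph i
catalogued⇒≅ G G≡a (i , any) =
  let σ , a≡H = Any.satisfied any in i , σ , λ u v → trans (G≡a u v) (a≡H u v)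

catalogue-complete : ∀ k → 1 ≤ k → k ≤ 3 → (G : Graph k) → ∃ λ i → G ≅ graph i
catalogue-complete 1 _ _ G = catalogued⇒≅ G (λ { 0F 0F → refl }) (catalogued₁ (adj G 0F 0F))
catalogue-complete 2 _ _ G = catalogued⇒≅ G
  (λ { 0F 0F → refl ; 1F 1F → refl ; 0F 1F → refl ; 1F 0F → adj-sym G 1F 0F })
  (catalogued₂ (adj G 0F 0F) (adj G 1F 1F) (adj G 0F 1F))
catalogue-complete 3 _ _ G = catalogued⇒≅ G
  (λ { 0F 0F → refl ; 1F 1F → refl ; 2F 2F → refl
     ; 0F 1F → refl ; 1F 0F → adj-sym G 1F 0F
     ; 0F 2F → refl ; 2F 0F → adj-sym G 2F 0F
     ; 1F 2F → refl ; 2F 1F → adj-sym G 2F 1F })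
  (catalogued₃ (adj G 0F 0F) (adj G 1F 1F) (adj G 2F 2F) (adj G 0F 1F) (adj G 0F 2F) (adj G 1F 2F))
catalogue-complete (suc (suc (suc (suc _)))) _ (s≤s (s≤s (s≤s ()))) G

-- The catalogue has no repetitions

-- As there are at most three vertices, code determines the number of vertices of each degree,
-- with and without a loop.
code : Graph k → ℕ
code H = ∑ λ u → 4 ^ (2 * degree H u + weight H u u)

code-≅ : ∀ {G : Graph m} {H : Graph n} → G ≅ H → code G ≡ code H
code-≅ {G = G} {H} (σ , G≡H) = sym (trans (∑-permute _ σ) (∑-cong λ u →
  cong₂ (λ d l → 4 ^ (2 * d + l)) (degree-σ u) (weight-σ u u)))
  where
  weight-σ : ∀ u v → weight H (σ ⟨$⟩ʳ u) (σ ⟨$⟩ʳ v) ≡ weight G u v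
  weight-σ u v = cong (if_then 1 else 0) (sym (G≡H u v))
  degree-σ : ∀ u → degree H (σ ⟨$⟩ʳ u) ≡ degree G u
  degree-σ u = trans (∑-permute _ σ) (∑-cong (weight-σ u))

opaque
  unfolding ∑

  -- Non-isomorphism is settled by an invariant: evaluation shows that degrees and loops already
  -- tell the twenty-eight graphs apart.
  code-injective : ∀ i j → code (graph i) ≡ code (graph j) → i ≡ j
  code-injective = from-yes (all? λ i → all? λ j → (code (graph i) ℕ.≟ code (graph j)) →-dec i ≟ j)

catalogue-irredundant : ∀ i j → graph i ≅ graph j → i ≡ j
catalogue-irredundant i j = code-injective i j ∘ code-≅ {G = graph i} {graph j}

-- The path as a minimizer for the whole catalogue

all-PathMinimal : ∀ e {Hs} → All (AllMinimize e) Hs → All PathMinimal Hs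
all-PathMinimal e = All.map {P = AllMinimize e} {Q = PathMinimal} λ {H} → AllMinimize⇒PathMinimal {e} H

all-unique-PathMinimal : ∀ {Hs} → All PathUniqueMinimizer Hs → All PathMinimal Hs
all-unique-PathMinimal =
  All.map {P = PathUniqueMinimizer} {Q = PathMinimal} λ {H} → PathUniqueMinimizer⇒PathMinimal H

-- Rearranges the cases from the grouping by kind of minimizer into the order of `catalogue`.
path-minimal :
  All PathMinimal (H₁ ∷ H₃ ∷ H₉ ∷ []) → All PathMinimal (H₂ ∷ H₄ ∷ H₁₀ ∷ []) →
  All PathMinimal (H₅ ∷ H₆ ∷ H₁₁ ∷ H₁₃ ∷ []) → All PathMinimal (H₁₂ ∷ H₁₄ ∷ []) →
  All PathMinimal (H₈ ∷ H₁₇ ∷ []) → All PathMinimal (H₁₈ ∷ []) → All PathMinimal (H₂₃ ∷ H₂₅ ∷ []) →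
  All PathMinimal (H₂₈ ∷ []) → PathMinimal H₁₉ →
  All PathMinimal (H₇ ∷ H₁₅ ∷ H₁₆ ∷ H₂₀ ∷ H₂₁ ∷ H₂₂ ∷ H₂₄ ∷ H₂₆ ∷ H₂₇ ∷ []) →
  VecAll.All PathMinimal catalogue
path-minimal (p₁ ∷ p₃ ∷ p₉ ∷ []) (p₂ ∷ p₄ ∷ p₁₀ ∷ []) (p₅ ∷ p₆ ∷ p₁₁ ∷ p₁₃ ∷ []) (p₁₂ ∷ p₁₄ ∷ [])
  (p₈ ∷ p₁₇ ∷ []) (p₁₈ ∷ []) (p₂₃ ∷ p₂₅ ∷ []) (p₂₈ ∷ []) p₁₉
  (p₇ ∷ p₁₅ ∷ p₁₆ ∷ p₂₀ ∷ p₂₁ ∷ p₂₂ ∷ p₂₄ ∷ p₂₆ ∷ p₂₇ ∷ []) =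
  p₁ ∷ p₂ ∷ p₃ ∷ p₄ ∷ p₅ ∷ p₆ ∷ p₇ ∷ p₈ ∷ p₉ ∷ p₁₀ ∷ p₁₁ ∷ p₁₂ ∷ p₁₃ ∷ p₁₄ ∷
  p₁₅ ∷ p₁₆ ∷ p₁₇ ∷ p₁₈ ∷ p₁₉ ∷ p₂₀ ∷ p₂₁ ∷ p₂₂ ∷ p₂₃ ∷ p₂₄ ∷ p₂₅ ∷ p₂₆ ∷ p₂₇ ∷ p₂₈ ∷ []
  where open VecAll using ([]; _∷_)

catalogue-PathMinimal : ∀ i → PathMinimal (lookup catalogue i)
catalogue-PathMinimal = lookup⁺ {P = PathMinimal} (path-minimal
  (all-PathMinimal _ minimizers-0) (all-PathMinimal _ minimizers-1)
  (all-PathMinimal _ minimizers-2) (all-PathMinimal _ minimizers-3)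
  (all-PathMinimal _ minimizers-2ⁿ) (all-PathMinimal _ minimizers-2ⁿ+1)
  (all-PathMinimal _ minimizers-3·2ⁿ⁻¹) (all-PathMinimal _ minimizers-3ⁿ)
  H₁₉-PathMinimal (all-unique-PathMinimal path-unique-minimizers))

mainTheorem16 :
  -- up to isomorphism, the graphs on one, two or three vertices are exactly H₁, …, H₂₈
  (∀ (i : Fin 28) → 1 ≤ proj₁ (lookup catalogue i) × proj₁ (lookup catalogue i) ≤ 3) ×
  (∀ (k : ℕ) → 1 ≤ k → k ≤ 3 → (G : Graph k) → ∃ λ (i : Fin 28) → G ≅ proj₂ (lookup catalogue i)) ×
  (∀ (i j : Fin 28) → proj₂ (lookup catalogue i) ≅ proj₂ (lookup catalogue j) → i ≡ j) ×
  -- the path is always a minimizer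
  (∀ (i : Fin 28) (n : ℕ) → 2 ≤ n → (t : Graph n) → IsTree t →
    hom (path n) (proj₂ (lookup catalogue i)) ≤ hom t (proj₂ (lookup catalogue i))) ×
  -- (i)
  All (AllMinimize (λ n → 0)) (H₁ ∷ H₃ ∷ H₉ ∷ []) ×
  All (AllMinimize (λ n → 1)) (H₂ ∷ H₄ ∷ H₁₀ ∷ []) ×
  All (AllMinimize (λ n → 2)) (H₅ ∷ H₆ ∷ H₁₁ ∷ H₁₃ ∷ []) ×
  All (AllMinimize (λ n → 3)) (H₁₂ ∷ H₁₄ ∷ []) ×
  All (AllMinimize (λ n → 2 ^ n)) (H₈ ∷ H₁₇ ∷ []) ×
  All (AllMinimize (λ n → 2 ^ n + 1)) (H₁₈ ∷ []) ×
  All (AllMinimize (λ n → 3 * 2 ^ (n ∸ 1))) (H₂₃ ∷ H₂₅ ∷ []) ×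
  All (AllMinimize (λ n → 3 ^ n)) (H₂₈ ∷ []) ×
  -- (ii)
  (∀ (n : ℕ) → 2 ≤ n → (t : Graph n) → IsTree t →
    IsMinimizer (proj₂ H₁₉) t ⇔ HasBalancedBipartition t) ×
  -- (iii)
  All PathUniqueMinimizer (H₇ ∷ H₁₅ ∷ H₁₆ ∷ H₂₀ ∷ H₂₁ ∷ H₂₂ ∷ H₂₄ ∷ H₂₆ ∷ H₂₇ ∷ [])
mainTheorem16 =
  catalogue-sizes , catalogue-complete , catalogue-irredundant , catalogue-PathMinimal ,
  minimizers-0 , minimizers-1 , minimizers-2 , minimizers-3 , minimizers-2ⁿ , minimizers-2ⁿ+1 ,
  minimizers-3·2ⁿ⁻¹ , minimizers-3ⁿ , H₁₉-minimizers , path-unique-minimizers
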